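{- There exists $\delta>0$ such that for all sufficiently large $n$ (in terms of $\delta$) there exist a subgraph $F\subseteq K_n$ and an edge-coloring of $F$ using at most $n$ colors with the following properties: (I) every color class consists of vertex-disjoint edges and $2$-edge paths; (II) for every triangle $xyz$ in $K_n$ such that $xy$ and $yz$ receive the same color $i$ and $xz$ receives color $\ell$, the vertex $y$ is isolated in color class $\ell$ (i.e. no edge of color $\ell$ is incident to $y$), and the edge $xz$ forms a component of color class $\ell$; (III) $F$ contains no bad subgraph; (IV) the graph $L=K_n-E(F)$ of uncolored edges has maximum degree at most $n^{1-\delta}$; (V) for each edge $xy\in E(L)$ and each type $t\in\{a,b,c,d,e,f\}$, there are at most $n^{1-\delta}$ edges $x'y'\in E(L)$ with $\{x,y\}\cap\{x',y'\}=\emptyset$ such that $\{xy,x'y'\}$ completes a bad subgraph of type $t$.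
   Context: A bad subgraph is a subgraph of $K_n$ on distinct vertices $v_0,\dots,v_4$ (only $v_0,\dots,v_3$ for type $a$) whose edges carry colors $i,\ell,m$, pairwise distinct, in one of the following patterns (the subgraph consists exactly of the listed edges): type $a$: $v_0v_1,v_2v_3$ colored $\ell$ and $v_1v_2,v_3v_0$ colored $i$. type $b$: $v_0v_1,v_1v_2,v_3v_4$ colored $i$ and $v_2v_3,v_4v_0$ colored $\ell$. type $c$: $v_0v_1,v_1v_2$ colored $i$; $v_0v_2,v_3v_4$ colored $\ell$; $v_2v_3,v_1v_4$ colored $m$. type $d$, one of: $v_0v_1,v_1v_2$ colored $i$, $v_1v_4,v_3v_4$ colored $\ell$, $v_2v_3,v_4v_0$ colored $m$; or $v_0v_1,v_1v_2$ colored $i$, $v_0v_4,v_3v_4$ colored $\ell$, $v_1v_4,v_2v_3$ colored $m$; or $v_0v_1,v_1v_2$ colored $i$, $v_1v_4,v_1v_3$ colored $\ell$, $v_2v_3,v_4v_0$ colored $m$; or $v_0v_1,v_1v_2$ colored $i$, $v_0v_4,v_4v_3$ colored $\ell$, $v_1v_3,v_2v_4$ colored $m$. type $e$, one of: $v_0v_1,v_1v_2$ colored $i$, $v_1v_4,v_0v_3$ colored $\ell$, $v_2v_3,v_4v_0$ colored $m$; or $v_0v_1,v_1v_2$ colored $i$, $v_0v_4,v_1v_3$ colored $\ell$, $v_2v_3,v_4v_1$ colored $m$. type $f$, one of: $v_0v_1,v_2v_3$ colored $i$, $v_1v_2,v_3v_4$ colored $\ell$, $v_1v_3,v_4v_0$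 colored $m$; or $v_0v_1,v_2v_3$ colored $i$, $v_1v_2,v_3v_4$ colored $\ell$, $v_1v_4,v_3v_0$ colored $m$. Given the partial coloring of $K_n$ (edges of $F$ colored, edges of $L$ uncolored), a set $E'$ of uncolored edges completes a bad subgraph of type $t$ if there is a way to assign colors to the edges of $E'$ so that, together with already colored edges of $F$, a bad subgraph of type $t$ is created. -}

module Defs where

open import Data.Nat using (ℕ; _≤_; _*_; _^_)
open import Data.Fin using (Fin; #_) renaming (_<_ to _<ᶠ_)
open import Data.Maybe using (Maybe; just; nothing)
open import Data.Product using (Σ; ∃; _×_; _,_)
open import Data.Sum using (_⊎_)
open import Data.List using (List; []; _∷_; length)
open import Data.List.Relation.Unary.All using (All)
open import Data.List.Relation.Unary.Any using (Any)
open import Data.List.Relation.Unary.Unique.Propositional using (Unique)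
open import Relation.Binary.PropositionalEquality using (_≡_; _≢_)
open import Relation.Nullary using (¬_)
open import Function.Definitions using (Injective)

-- Partial edge-colourings of K_n with at most n colours.
-- Vertices of K_n are Fin n, colours are Fin n (hence at most n colours).
-- col x y ≡ just i  : the edge xy belongs to F and has colour i
-- col x y ≡ nothing : the edge xy is uncoloured, i.e. belongs to L
-- (for x ≢ y; the diagonal is required to be nothing and is irrelevant).

PColouring : ℕ → Set
PColouring n = Fin n → Fin n → Maybe (Fin n)

WellFormed : ∀ {n} → PColouring n → Set
WellFormed {n} col = (∀ x y → col x y ≡ col y x) × (∀ x → col x x ≡ nothing)

-- (I) colour class i consists of vertex-disjoint edges and 2-edge paths:
-- whenever two distinct i-edges xy, yz share the vertex y, there are no
-- further i-edges at x, y or z (so every component of colour class i has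
-- at most two edges and is not a triangle).
ClassIsEdgesAnd2Paths : ∀ {n} → PColouring n → Fin n → Set
ClassIsEdgesAnd2Paths {n} col i =
  ∀ (x y z : Fin n) → x ≢ z →
    col x y ≡ just i → col y z ≡ just i →
    (∀ w → col x w ≡ just i → w ≡ y) ×
    (∀ w → col y w ≡ just i → (w ≡ x ⊎ w ≡ z)) ×
    (∀ w → col z w ≡ just i → w ≡ y)

TriangleProperty : ∀ {n} → PColouring n → Set
TriangleProperty {n} col =
  ∀ (x y z : Fin n) (i ℓ : Fin n) → x ≢ y → y ≢ z → x ≢ z →
    col x y ≡ just i → col y z ≡ just i → col x z ≡ just ℓ →
    (∀ w → col y w ≢ just ℓ) ×
    (∀ w → col x w ≡ just ℓ → w ≡ z) ×
    (∀ w → col z w ≡ just ℓ → w ≡ x)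

-- Bad subgraphs.
-- A pattern on nv vertices v_0..v_{nv-1} and nc colour slots
-- (slot 0 = i, slot 1 = ℓ, slot 2 = m) is a list of edges with slots.

record Pattern : Set where
  field
    nv     : ℕ
    nc     : ℕ
    edges  : List (Fin nv × Fin nv × Fin nc)

open Pattern public

data BadType : Set where
  a b c d e f : BadType

private
  _—_∶_ : ∀ {k m} → Fin k → Fin k → Fin m → Fin k × Fin k × Fin m
  u — v ∶ s = u , v , s
  infix 5 _—_∶_

  I L M : Fin 3
  I = # 0
  L = # 1
  M = # 2

  I₂ L₂ : Fin 2
  I₂ = # 0
  L₂ = # 1

  v0 v1 v2 v3 v4 : Fin 5
  v0 = # 0
  v1 = # 1
  v2 = # 2
  v3 = # 3
  v4 = # 4

  w0 w1 w2 w3 : Fin 4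
  w0 = # 0
  w1 = # 1
  w2 = # 2
  w3 = # 3

  mk5 : List (Fin 5 × Fin 5 × Fin 3) → Pattern
  mk5 es = record { nv = 5 ; nc = 3 ; edges = es }

patterns : BadType → List Pattern
patterns a =
  record { nv = 4 ; nc = 2 ; edges =
    (w0 — w1 ∶ L₂) ∷ (w2 — w3 ∶ L₂) ∷ (w1 — w2 ∶ I₂) ∷ (w3 — w0 ∶ I₂) ∷ [] } ∷ []
patterns b =
  record { nv = 5 ; nc = 2 ; edges =
    (v0 — v1 ∶ I₂) ∷ (v1 — v2 ∶ I₂) ∷ (v3 — v4 ∶ I₂) ∷
    (v2 — v3 ∶ L₂) ∷ (v4 — v0 ∶ L₂) ∷ [] } ∷ []
patterns c =
  mk5 ((v0 — v1 ∶ I) ∷ (v1 — v2 ∶ I) ∷ (v0 — v2 ∶ L) ∷ (v3 — v4 ∶ L) ∷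
       (v2 — v3 ∶ M) ∷ (v1 — v4 ∶ M) ∷ []) ∷ []
patterns d =
  mk5 ((v0 — v1 ∶ I) ∷ (v1 — v2 ∶ I) ∷ (v1 — v4 ∶ L) ∷ (v3 — v4 ∶ L) ∷
       (v2 — v3 ∶ M) ∷ (v4 — v0 ∶ M) ∷ []) ∷
  mk5 ((v0 — v1 ∶ I) ∷ (v1 — v2 ∶ I) ∷ (v0 — v4 ∶ L) ∷ (v3 — v4 ∶ L) ∷
       (v1 — v4 ∶ M) ∷ (v2 — v3 ∶ M) ∷ []) ∷
  mk5 ((v0 — v1 ∶ I) ∷ (v1 — v2 ∶ I) ∷ (v1 — v4 ∶ L) ∷ (v1 — v3 ∶ L) ∷
       (v2 — v3 ∶ M) ∷ (v4 — v0 ∶ M) ∷ []) ∷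
  mk5 ((v0 — v1 ∶ I) ∷ (v1 — v2 ∶ I) ∷ (v0 — v4 ∶ L) ∷ (v4 — v3 ∶ L) ∷
       (v1 — v3 ∶ M) ∷ (v2 — v4 ∶ M) ∷ []) ∷ []
patterns e =
  mk5 ((v0 — v1 ∶ I) ∷ (v1 — v2 ∶ I) ∷ (v1 — v4 ∶ L) ∷ (v0 — v3 ∶ L) ∷
       (v2 — v3 ∶ M) ∷ (v4 — v0 ∶ M) ∷ []) ∷
  mk5 ((v0 — v1 ∶ I) ∷ (v1 — v2 ∶ I) ∷ (v0 — v4 ∶ L) ∷ (v1 — v3 ∶ L) ∷
       (v2 — v3 ∶ M) ∷ (v4 — v1 ∶ M) ∷ []) ∷ []
patterns f =
  mk5 ((v0 — v1 ∶ I) ∷ (v2 — v3 ∶ I) ∷ (v1 — v2 ∶ L) ∷ (v3 — v4 ∶ L) ∷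
       (v1 — v3 ∶ M) ∷ (v4 — v0 ∶ M) ∷ []) ∷
  mk5 ((v0 — v1 ∶ I) ∷ (v2 — v3 ∶ I) ∷ (v1 — v2 ∶ L) ∷ (v3 — v4 ∶ L) ∷
       (v1 — v4 ∶ M) ∷ (v3 — v0 ∶ M) ∷ []) ∷ []

SameEdge : ∀ {n} → Fin n × Fin n → Fin n × Fin n → Set
SameEdge (x , y) (u , v) = (x ≡ u × y ≡ v) ⊎ (x ≡ v × y ≡ u)

-- E' (a list of uncoloured edges) completes the bad pattern P:
-- there are distinct vertices v and pairwise distinct colours c such that
-- every edge of the pattern is either an edge of F with the prescribed
-- colour, or an uncoloured edge of E' (which is then assigned the
-- prescribed colour), and every edge of E' is an edge of the pattern.
-- With E' = [] this says that F contains a copy of P.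
CompletesPattern : ∀ {n} → PColouring n → List (Fin n × Fin n) → Pattern → Set
CompletesPattern {n} col E' P =
  Σ (Fin (nv P) → Fin n) λ v → Injective _≡_ _≡_ v ×
  Σ (Fin (nc P) → Fin n) λ c → Injective _≡_ _≡_ c ×
  All (λ { (p , q , s) →
           col (v p) (v q) ≡ just (c s)
           ⊎ (col (v p) (v q) ≡ nothing × Any (SameEdge (v p , v q)) E') })
      (edges P) ×
  All (λ ed → Any (λ { (p , q , s) → SameEdge ed (v p , v q) }) (edges P)) E'

Completes : ∀ {n} → PColouring n → List (Fin n × Fin n) → BadType → Set
Completes col E' t = Any (CompletesPattern col E') (patterns t)

NoBadSubgraph : ∀ {n} → PColouring n → Set
NoBadSubgraph col = ∀ t → ¬ Completes col [] t

-- Counting bounds.  For δ = p / q, "k ≤ n^(1-δ)" for naturals k, n ≥ 1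
-- is equivalent to k^q * n^p ≤ n^q.
LeRoot : ℕ → ℕ → ℕ → ℕ → Set
LeRoot k n p q = k ^ q * n ^ p ≤ n ^ q

AtMostVerts : ∀ {n} → ℕ → ℕ → (Fin n → Set) → Set
AtMostVerts {n} p q P =
  ∀ (S : List (Fin n)) → Unique S → All P S → LeRoot (length S) n p q

AtMostEdges : ∀ {n} → ℕ → ℕ → (Fin n → Fin n → Set) → Set
AtMostEdges {n} p q P =
  ∀ (S : List (Fin n × Fin n)) → Unique S →
    All (λ { (x' , y') → x' <ᶠ y' × P x' y' }) S → LeRoot (length S) n p q

MaxDegL : ∀ {n} → PColouring n → ℕ → ℕ → Set
MaxDegL {n} col p q =
  ∀ (x : Fin n) → AtMostVerts p q (λ y → y ≢ x × col x y ≡ nothing)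

FewCompletions : ∀ {n} → PColouring n → ℕ → ℕ → Set
FewCompletions {n} col p q =
  ∀ (x y : Fin n) → x ≢ y → col x y ≡ nothing → ∀ (t : BadType) →
    AtMostEdges p q (λ x' y' →
      col x' y' ≡ nothing ×
      x' ≢ x × x' ≢ y × y' ≢ x × y' ≢ y ×
      Completes col ((x , y) ∷ (x' , y') ∷ []) t)

{-# OPTIONS --safe #-}

-- The colouring constructed here leaves no edge uncoloured, so (IV) and (V) hold trivially with δ = 1.
--
-- Vertices are pairs (x , i) with x in a commutative quasigroup Q and i one of 64 types.  If x ≠ y, the
-- edge (x , i)(y , j) gets the colour (φ(i , j) , x ∙ y), where φ is a fixed 64 × 64 array with 62 symbols
-- (transposed when x comes after y).  Edges with x = y get a colour that only depends on {i , j}, except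
-- that 32 disjoint pairs of types get a colour that only depends on x.  This uses 62|Q| + |Q| + O(1)
-- colours on 64|Q| vertices, hence after deleting vertices it suffices that the available orders |Q|
-- are dense up to a factor close to 64 / 63.
--
-- Q is rigid: every solution in Q of the equations of pattern a or f is degenerate.  This forces any bad
-- subgraph into very few fibres over Q, where it turns into a local condition on φ.  Rigid quasigroups are
-- closed under products, and quadratic quasigroups over the fields with 11 and 23 elements are rigid.
-- The array φ was found by simulated annealing; its conditions are verified by evaluation.
module Submission where

open import Defs hiding (a; b; c; d; e; f)
open import Data.Bool using (Bool; true; false; if_then_else_; _∨_; _∧_; not; T)
open import Data.Bool.Properties using (T-∧; T-∨; T-not-≡)
open import Data.Empty using (⊥; ⊥-elim)
open import Data.Fin using (Fin; #_; toℕ; fromℕ<)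
import Data.Fin as Fin
import Data.Fin.Properties as Fin
open import Data.List using (List; []; _∷_; map)
open import Data.List.Relation.Unary.All using (All; []; _∷_)
open import Data.List.Relation.Unary.Any using (Any; here; there)
open import Data.Maybe using (Maybe; just; nothing)
import Data.Maybe as Maybe
open import Data.Nat hiding (_≟_; _!)
open import Data.Nat.DivMod using (_mod_; m%n<n)
open import Data.Nat.Properties hiding (_≟_)
open import Data.Product using (Σ; ∃; ∃₂; _×_; _,_; proj₁; proj₂)
open import Data.Product.Function.NonDependent.Propositional using (_×-↔_)
open import Data.Sum using (_⊎_; inj₁; inj₂)
import Data.Sum as Sum
open import Data.Sum.Function.Propositional using (_⊎-↔_)
open import Data.Unit using (⊤; tt)
open import Function using (_∘_)
open import Function.Bundles using (_↔_; Inverse; Injection; Equivalence; mk↔ₛ′)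
open import Function.Definitions using (Injective)
open import Function.Properties.Inverse using (↔-refl; ↔-sym; ↔-trans; ↔⇒↣)
open import Relation.Binary using (Tri; tri<; tri≈; tri>)
open import Relation.Binary.PropositionalEquality
open import Relation.Nullary using (Dec; yes; no; contradiction)
open import Relation.Nullary.Decidable using (False; toWitnessFalse; map′; decidable-stable)

-- Rigid commutative quasigroups and the conditions on the array.

record RigidQuasigroup : Set₁ where
  infixl 7 _∙_
  field
    Carrier    : Set
    order      : ℕ
    index      : Carrier ↔ Fin order
    _∙_        : Carrier → Carrier → Carrier
    comm       : ∀ x y → x ∙ y ≡ y ∙ x
    cancelˡ    : ∀ x {y z} → x ∙ y ≡ x ∙ z → y ≡ z
    square-inj : ∀ {x y} → x ∙ x ≡ y ∙ y → x ≡ y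
    -- The hypotheses of the rigidity axioms are the equations that patterns `a` and `f` impose on
    -- the fibres of their vertices when every edge joins two fibres. The conclusion puts v₁ and v₃
    -- into one fibre.
    rigid-a    : ∀ {x₀ x₁ x₂ x₃} →
                 x₀ ∙ x₁ ≡ x₂ ∙ x₃ → x₁ ∙ x₂ ≡ x₃ ∙ x₀ → x₁ ≡ x₃
    rigid-f₁   : ∀ {x₀ x₁ x₂ x₃ x₄} → x₀ ∙ x₁ ≡ x₂ ∙ x₃ →
                 x₁ ∙ x₂ ≡ x₃ ∙ x₄ → x₁ ∙ x₃ ≡ x₄ ∙ x₀ → x₁ ≡ x₃
    rigid-f₂   : ∀ {x₀ x₁ x₂ x₃ x₄} → x₀ ∙ x₁ ≡ x₂ ∙ x₃ →
                 x₁ ∙ x₂ ≡ x₃ ∙ x₄ → x₁ ∙ x₄ ≡ x₃ ∙ x₀ → x₁ ≡ x₃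

  cancelʳ : ∀ {x y} z → x ∙ z ≡ y ∙ z → x ≡ y
  cancelʳ {x} {y} z eq = cancelˡ z (trans (comm z x) (trans eq (comm y z)))


-- `φ b r c` is the symbol of an edge from type `r` in one fibre to type `c` in another, and `b`
-- tells whether the fibre of `r` comes first. A coincidence `φ b r c ≡ φ b s c` is a two-edge path
-- whose centre has type `c`. From `avoids-a` on, each field is named after the pattern or condition
-- that it serves.
record Gadget (W : Set) (P : ℕ) : Set where
  field
    φ            : Bool → W → W → Fin P
    φ-flip       : ∀ b r c → φ (not b) c r ≡ φ b r c
    partner      : W → W
    partner-invol : ∀ i → partner (partner i) ≡ i
    path-end     : ∀ b {r s c d} → r ≢ s → φ b r c ≡ φ b s c →
                   φ b r d ≡ φ b r c → d ≡ c
    path-centre  : ∀ b {r s t c} → r ≢ s → φ b r c ≡ φ b s c →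
                   φ b t c ≡ φ b r c → t ≡ r ⊎ t ≡ s
    avoids-a     : ∀ b {r s c d} → r ≢ s → c ≢ d →
                   φ b r c ≡ φ b s d → φ b s c ≢ φ b r d
    avoids-f₂    : ∀ b {r₀ r₂ r₄ c₁ c₃} → c₁ ≢ c₃ → r₀ ≢ r₂ → r₀ ≢ r₄ → r₂ ≢ r₄ →
                   φ b r₀ c₁ ≡ φ b r₂ c₃ → φ b r₂ c₁ ≡ φ b r₄ c₃ →
                   φ b r₄ c₁ ≢ φ b r₀ c₃
    avoids-d₄    : ∀ b {r₀ r₂ r₃ c₁ c₄} → r₀ ≢ r₂ → r₀ ≢ r₃ → r₂ ≢ r₃ → c₁ ≢ c₄ →
                   φ b r₀ c₁ ≡ φ b r₂ c₁ → φ b r₀ c₄ ≡ φ b r₃ c₄ →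
                   φ b r₃ c₁ ≢ φ b r₂ c₄
    -- The two forks of this pattern share only their centre, and their ends may lie in two further
    -- fibres. Each of the three pairs of fibres has its own orientation.
    avoids-d₃    : ∀ b b′ b″ {t₀ t₁ t₂ t₃ t₄} → t₀ ≢ t₂ → t₄ ≢ t₃ →
                   φ b t₀ t₁ ≡ φ b t₂ t₁ → φ b′ t₄ t₁ ≡ φ b′ t₃ t₁ →
                   φ b″ t₂ t₃ ≢ φ b″ t₀ t₄
    -- The same pattern with all four ends in one fibre, where v₂v₃ and v₀v₄ both carry the special
    -- colour of that fibre and hence join partners.
    avoids-d₃-special : ∀ b {t₁ t₂ t₄} → partner t₄ ≢ t₂ → t₂ ≢ t₄ →
                   φ b (partner t₄) t₁ ≡ φ b t₂ t₁ →
                   φ b t₄ t₁ ≢ φ b (partner t₂) t₁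
    -- A label recurs in every fibre. The remaining conditions treat two fibres, in each of which
    -- types `i` and `j` are joined by the same label, together with at most one further vertex, of
    -- type `k`.
    label-a      : ∀ b {i j} → i ≢ j → partner i ≢ j → φ b i j ≢ φ b j i
    label-a′     : ∀ b {i j} → i ≢ j → partner i ≢ j → φ b i i ≢ φ b j j
    label-II     : ∀ b {i j} → i ≢ j → partner i ≢ j → φ b i i ≢ φ b j i
    label-d₂     : ∀ b {i j k} → i ≢ j → partner i ≢ j → k ≢ i → k ≢ j →
                   φ b k i ≡ φ b i i → φ b k j ≢ φ b j j
    label-d₂′    : ∀ b {i j k} → i ≢ j → partner i ≢ j → k ≢ i → k ≢ j →
                   φ b k i ≡ φ b j i → φ b k j ≢ φ b i j
    label-e₂     : ∀ b {i j k} → i ≢ j → partner i ≢ j → k ≢ i → k ≢ j →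
                   φ b i i ≡ φ b k i → φ b k j ≢ φ b j i
    label-e₂′    : ∀ b {i j k} → i ≢ j → partner i ≢ j → k ≢ i → k ≢ j →
                   φ b i j ≡ φ b k j → φ b k i ≢ φ b j j
    label-f₁     : ∀ b {i j k} → i ≢ j → partner i ≢ j → k ≢ i → k ≢ j →
                   φ b i i ≡ φ b j k → φ b i k ≢ φ b j j
    label-f₁′    : ∀ b {i j k} → i ≢ j → partner i ≢ j → k ≢ i → k ≢ j →
                   φ b i j ≡ φ b j k → φ b i k ≢ φ b j i


-- The blow-up of a rigid quasigroup by the array.

module Blowup (Q : RigidQuasigroup) {W : Set} {w P : ℕ} (W↔ : W ↔ Fin w) (G : Gadget W P) where
  open RigidQuasigroup Q
  open Gadget G

  Vertex : Set
  Vertex = Carrier × W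

  data Colour : Set where
    cross   : Fin P → Carrier → Colour
    special : Carrier → Colour
    label   : W → W → Colour

  idx : Carrier → Fin order
  idx = Inverse.to index

  idx-injective : ∀ {x y} → idx x ≡ idx y → x ≡ y
  idx-injective {x} {y} eq =
    trans (sym (Inverse.strictlyInverseʳ index x))
      (trans (cong (Inverse.from index) eq) (Inverse.strictlyInverseʳ index y))

  toʷ : W → Fin w
  toʷ = Inverse.to W↔

  toʷ-injective : ∀ {i j} → toʷ i ≡ toʷ j → i ≡ j
  toʷ-injective = Injection.injective (↔⇒↣ W↔)

  _≟ʷ_ : ∀ (i j : W) → Dec (i ≡ j)
  i ≟ʷ j = map′ toʷ-injective (cong toʷ) (toʷ i Fin.≟ toʷ j)

  -- `label-a` forces `φ` to be asymmetric in the two types, so the numbering of the fibres decides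
  -- in which order the types of an edge are read.
  below : Carrier → Carrier → Bool
  below x y with Fin.<-cmp (idx x) (idx y)
  ... | tri< _ _ _ = true
  ... | tri≈ _ _ _ = false
  ... | tri> _ _ _ = false

  below-flip : ∀ {x y} → x ≢ y → below y x ≡ not (below x y)
  below-flip {x} {y} x≢y with Fin.<-cmp (idx x) (idx y) | Fin.<-cmp (idx y) (idx x)
  ... | tri< p _ _ | tri< _ _ ¬p = contradiction p ¬p
  ... | tri< _ _ _ | tri≈ _ _ _  = refl
  ... | tri< _ _ _ | tri> _ _ _  = refl
  ... | tri≈ _ m _ | _           = contradiction (idx-injective m) x≢y
  ... | tri> _ _ _ | tri< _ _ _  = refl
  ... | tri> _ _ _ | tri≈ _ m _  = contradiction (sym (idx-injective m)) x≢y
  ... | tri> _ _ p | tri> ¬p _ _ = contradiction p ¬p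

  shade : Carrier → Carrier → W → W → Fin P
  shade x y = φ (below x y)

  shade-flip : ∀ {x y} → x ≢ y → ∀ i j → shade y x j i ≡ shade x y i j
  shade-flip {x} {y} x≢y i j rewrite below-flip x≢y = φ-flip (below x y) i j

  within : Carrier → W → W → Maybe Colour
  within x i j with i ≟ʷ j | partner i ≟ʷ j | toʷ i Fin.<? toʷ j
  ... | yes _ | _     | _     = nothing
  ... | no _  | yes _ | _     = just (special x)
  ... | no _  | no _  | yes _ = just (label i j)
  ... | no _  | no _  | no _  = just (label j i)

  colour : Vertex → Vertex → Maybe Colour
  colour (x , i) (y , j) with idx x Fin.≟ idx y
  ... | yes _ = within x i j
  ... | no  _ = just (cross (shade x y i j) (x ∙ y))

  data Edge : Vertex → Vertex → Colour → Set where
    cross    : ∀ {x y i j} → x ≢ y → Edge (x , i) (y , j) (cross (shade x y i j) (x ∙ y))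
    special  : ∀ {x i j} → i ≢ j → partner i ≡ j → Edge (x , i) (x , j) (special x)
    label    : ∀ {x i j} → i ≢ j → partner i ≢ j → Edge (x , i) (x , j) (label i j)
    label′   : ∀ {x i j} → i ≢ j → partner i ≢ j → Edge (x , i) (x , j) (label j i)

  edge : ∀ u v {k} → colour u v ≡ just k → Edge u v k
  edge (x , i) (y , j) eq with idx x Fin.≟ idx y
  edge (x , i) (y , j) refl | no  x≢y = cross (x≢y ∘ cong idx)
  edge (x , i) (y , j) eq | yes x≡y with idx-injective x≡y
  edge (x , i) (_ , j) eq | yes x≡y | refl with i ≟ʷ j | partner i ≟ʷ j | toʷ i Fin.<? toʷ j
  edge (x , i) (_ , j) refl | yes x≡y | refl | no i≢j | yes p | _     = special i≢j p
  edge (x , i) (_ , j) refl | yes x≡y | refl | no i≢j | no ¬p | yes _ = label i≢j ¬p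
  edge (x , i) (_ , j) refl | yes x≡y | refl | no i≢j | no ¬p | no _  = label′ i≢j ¬p

  colour-total : ∀ u v → u ≢ v → ∃ λ k → colour u v ≡ just k
  colour-total (x , i) (y , j) u≢v with idx x Fin.≟ idx y
  ... | no  _ = _ , refl
  ... | yes x≡y with idx-injective x≡y
  ...   | refl with i ≟ʷ j | partner i ≟ʷ j | toʷ i Fin.<? toʷ j
  ...     | yes refl | _     | _     = contradiction refl u≢v
  ...     | no _     | yes _ | _     = _ , refl
  ...     | no _     | no _  | yes _ = _ , refl
  ...     | no _     | no _  | no _  = _ , refl

  colour-diagonal : ∀ u → colour u u ≡ nothing
  colour-diagonal (x , i) with idx x Fin.≟ idx x
  ... | no ≢ = contradiction refl ≢
  ... | yes _ with i ≟ʷ i | partner i ≟ʷ i | toʷ i Fin.<? toʷ i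
  ...   | yes _ | _ | _ = refl
  ...   | no ≢  | _ | _ = contradiction refl ≢

  partner-sym : ∀ {i j} → partner i ≡ j → partner j ≡ i
  partner-sym refl = partner-invol _

  within-sym : ∀ x i j → within x i j ≡ within x j i
  within-sym x i j with i ≟ʷ j | partner i ≟ʷ j | toʷ i Fin.<? toʷ j
                     | j ≟ʷ i | partner j ≟ʷ i | toʷ j Fin.<? toʷ i
  ... | yes _ | _ | _ | yes _ | _ | _ = refl
  ... | yes p | _ | _ | no ≢ | _ | _ = contradiction (sym p) ≢
  ... | no ≢ | _ | _ | yes p | _ | _ = contradiction (sym p) ≢
  ... | no _ | yes _ | _ | no _ | yes _ | _ = refl
  ... | no _ | yes p | _ | no _ | no ¬p | _ = contradiction (partner-sym p) ¬p
  ... | no _ | no ¬p | _ | no _ | yes p | _ = contradiction (partner-sym p) ¬p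
  ... | no _ | no _ | yes p | no _ | no _ | yes q = contradiction q (Fin.<-asym p)
  ... | no _ | no _ | yes _ | no _ | no _ | no _ = refl
  ... | no _ | no _ | no _ | no _ | no _ | yes _ = refl
  ... | no ≢ | no _ | no ¬p | no _ | no _ | no ¬q with Fin.<-cmp (toʷ i) (toʷ j)
  ...   | tri< p _ _ = contradiction p ¬p
  ...   | tri≈ _ m _ = contradiction (toʷ-injective m) ≢
  ...   | tri> _ _ q = contradiction q ¬q

  colour-sym : ∀ u v → colour u v ≡ colour v u
  colour-sym (x , i) (y , j) with idx x Fin.≟ idx y | idx y Fin.≟ idx x
  ... | yes p | no ≢ = contradiction (sym p) ≢
  ... | no ≢ | yes p = contradiction (sym p) ≢
  ... | no x≢y | no _ =
    cong₂ (λ c z → just (cross c z)) (sym (shade-flip (x≢y ∘ cong idx) i j)) (comm x y)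
  ... | yes p | yes _ with idx-injective p
  ...   | refl = within-sym x i j

  -- Pairs of edges of equal colour.

  data Inner : Carrier → W → W → Carrier → W → W → Set where
    special : ∀ {x i j i′ j′} → partner i ≡ j → partner i′ ≡ j′ → Inner x i j x i′ j′
    label   : ∀ {x y i j} → i ≢ j → partner i ≢ j → Inner x i j y i j
    label′  : ∀ {x y i j} → i ≢ j → partner i ≢ j → Inner x i j y j i

  -- Two edges of one colour, with the colour itself eliminated. What remains is an equation in the
  -- quasigroup and one in the array, or a relation between types within fibres.
  data Twin : Vertex → Vertex → Vertex → Vertex → Set where
    cross : ∀ {x y x′ y′ i j i′ j′} → x ≢ y → x′ ≢ y′ → x ∙ y ≡ x′ ∙ y′ →
            shade x y i j ≡ shade x′ y′ i′ j′ → Twin (x , i) (y , j) (x′ , i′) (y′ , j′)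
    inner : ∀ {x y i j i′ j′} → Inner x i j y i′ j′ → Twin (x , i) (x , j) (y , i′) (y , j′)

  twin′ : ∀ {u v u′ v′ k k′} → Edge u v k → Edge u′ v′ k′ → k ≡ k′ → Twin u v u′ v′
  twin′ (cross {x} {y} {i} {j} p) (cross q) eq =
    cross p q (cong (λ { (cross _ z) → z ; _ → x }) eq)
              (cong (λ { (cross γ _) → γ ; _ → shade x y i j }) eq)
  twin′ (special _ p) (special _ q) refl = inner (special p q)
  twin′ (label p q)  (label _ _)  refl = inner (label p q)
  twin′ (label p q)  (label′ _ _) refl = inner (label′ p q)
  twin′ (label′ p q) (label _ _)  refl = inner (label′ p q)
  twin′ (label′ p q) (label′ _ _) refl = inner (label p q)

  data Fork : Vertex → Vertex → Vertex → Set where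
    fork : ∀ {x y i j k} → x ≢ y → i ≢ k → shade x y i j ≡ shade x y k j →
           Fork (x , i) (y , j) (x , k)

  -- Cancelling the centre in the quasigroup puts both ends of a monochromatic path into one fibre.
  -- Edges within a fibre never form such a path: a special colour joins each type to its partner,
  -- and a label occurs on a single edge of each fibre.
  fork′ : ∀ {u v w} → u ≢ w → Twin u v v w → Fork u v w
  fork′ u≢w (cross {x} {y} {j = j} {j′ = k} p q m s) with cancelˡ y (trans (comm y x) m)
  ... | refl = fork p (λ { refl → u≢w refl }) (trans s (shade-flip p k j))
  fork′ u≢w (inner (special p q)) = contradiction (cong (_ ,_) (trans (sym (partner-sym p)) q)) u≢w
  fork′ u≢w (inner (label i≢j _)) = contradiction refl i≢j
  fork′ u≢w (inner (label′ _ _)) = contradiction refl u≢w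

  -- Within one fibre `partner` is an involution and a label determines the two types that it joins,
  -- so following either along the chain makes two distinct vertices coincide.
  inner-chain : ∀ {v₀ v₁ v₂ v₃ v₄} → v₀ ≢ v₂ → v₁ ≢ v₂ → v₁ ≢ v₃ → v₂ ≢ v₃ → proj₁ v₀ ≡ proj₁ v₁ →
                proj₁ v₁ ≡ proj₁ v₂ → Twin v₀ v₁ v₂ v₃ → Twin v₁ v₂ v₃ v₄ → ⊥
  inner-chain _ _ _ _ p _ (cross q _ _ _) _ = q p
  inner-chain _ _ _ _ _ p (inner _) (cross q _ _ _) = q p
  inner-chain v₀≢v₂ _ _ _ _ _ (inner (special p _)) (inner (special q _)) =
    v₀≢v₂ (cong (_ ,_) (trans (sym (partner-sym p)) q))
  inner-chain _ _ v₁≢v₃ _ _ _ (inner (special _ _)) (inner (label _ _)) = v₁≢v₃ refl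
  inner-chain _ _ _ v₂≢v₃ _ _ (inner (special _ _)) (inner (label′ _ _)) = v₂≢v₃ refl
  inner-chain v₀≢v₂ _ _ _ _ refl (inner (label _ _)) _ = v₀≢v₂ refl
  inner-chain _ v₁≢v₂ _ _ _ refl (inner (label′ _ _)) _ = v₁≢v₂ refl

  -- Excluding the bad subgraphs, one pattern at a time.

  a-free : ∀ {v₀ v₁ v₂ v₃} → v₀ ≢ v₂ → v₁ ≢ v₂ → v₁ ≢ v₃ → v₂ ≢ v₃ →
           Twin v₀ v₁ v₂ v₃ → Twin v₁ v₂ v₃ v₀ → ⊥
  -- Rigidity gives x₁ = x₃ and cancellation then gives x₀ = x₂. The cycle lies over two fibres,
  -- where the array excludes it.
  a-free v₀≢v₂ _ v₁≢v₃ _ (cross {x₀} {x₁} p _ m s) (cross _ _ m′ s′) with rigid-a m m′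
  ... | refl with cancelʳ x₁ m
  ...   | refl = avoids-a _ (λ { refl → v₀≢v₂ refl }) (λ { refl → v₁≢v₃ refl }) s
                   (trans (sym (shade-flip p _ _)) (trans s′ (shade-flip p _ _)))
  a-free _ _ _ _ (cross p _ _ _) (inner (special _ _)) = p refl
  a-free _ _ _ _ (cross _ q _ s) (inner (label i≢j ¬p)) = label-a _ i≢j ¬p (trans (sym (shade-flip q _ _)) s)
  a-free _ _ _ _ (cross _ q _ s) (inner (label′ i≢j ¬p)) = label-a′ _ i≢j ¬p (trans (sym (shade-flip q _ _)) s)
  a-free _ _ _ _ (inner (special _ _)) (cross p _ _ _) = p refl
  a-free _ _ _ _ (inner (label i≢j ¬p)) (cross p _ _ s) = label-a _ i≢j ¬p (sym (trans s (shade-flip p _ _)))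
  a-free _ _ _ _ (inner (label′ i≢j ¬p)) (cross p _ _ s) = label-a′ _ i≢j ¬p (sym (trans s (shade-flip p _ _)))
  a-free v₀≢v₂ v₁≢v₂ v₁≢v₃ v₂≢v₃ t@(inner _) t′@(inner _) =
    inner-chain v₀≢v₂ v₁≢v₂ v₁≢v₃ v₂≢v₃ refl refl t t′

  -- Since v₀ and v₂ share a fibre, equal colours on v₂v₃ and v₄v₀ put v₃ and v₄ into one fibre as
  -- well. But v₃v₄ has the colour of v₀v₁, which joins two fibres.
  b-free : ∀ {v₀ v₁ v₂ v₃ v₄} → Fork v₀ v₁ v₂ → Twin v₀ v₁ v₃ v₄ → Twin v₂ v₃ v₄ v₀ → ⊥
  b-free (fork {x} _ _ _) (cross _ q _ _) (cross _ _ m _) = q (cancelˡ x (trans m (comm _ x)))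
  b-free (fork _ _ _) (cross _ q _ _) (inner _) = q refl
  b-free (fork p _ _) (inner _) _ = p refl

  c-free : ∀ {v₀ v₁ v₂ v₃ v₄} → Fork v₀ v₁ v₂ → Twin v₀ v₂ v₃ v₄ → Twin v₂ v₃ v₁ v₄ → ⊥
  c-free (fork _ _ _) (cross p _ _ _) _ = p refl
  c-free (fork p _ _) (inner _) (cross _ _ m _) = p (cancelʳ _ m)
  c-free (fork p _ _) (inner _) (inner _) = p refl

  d₁-free : ∀ {v₀ v₁ v₂ v₃ v₄} → Fork v₀ v₁ v₂ → Fork v₁ v₄ v₃ → Twin v₂ v₃ v₄ v₀ → ⊥
  d₁-free (fork {x} _ _ _) (fork q _ _) (cross _ _ m _) = q (cancelˡ x (trans m (comm _ x)))
  d₁-free (fork p _ _) (fork _ _ _) (inner _) = p refl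

  d₂-free : ∀ {v₀ v₁ v₂ v₃ v₄} → Fork v₀ v₁ v₂ → Fork v₀ v₄ v₃ → Twin v₁ v₄ v₂ v₃ → ⊥
  d₂-free (fork _ _ _) (fork _ _ _) (cross _ q _ _) = q refl
  d₂-free (fork p _ _) (fork _ _ _) (inner (special _ _)) = p refl
  d₂-free (fork _ n s) (fork _ n′ s′) (inner (label i≢j ¬p)) = label-d₂ _ i≢j ¬p n n′ s s′
  d₂-free (fork _ n s) (fork _ n′ s′) (inner (label′ i≢j ¬p)) = label-d₂′ _ i≢j ¬p n′ n s s′

  d₃-free : ∀ {v₀ v₁ v₂ v₃ v₄} → v₂ ≢ v₄ → v₃ ≢ v₄ →
            Fork v₀ v₁ v₂ → Fork v₄ v₁ v₃ → Twin v₂ v₃ v₄ v₀ → ⊥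
  d₃-free _ _ (fork _ n s) (fork _ n′ s′) (cross p _ _ s″) =
    avoids-d₃ _ _ _ n n′ s s′ (trans s″ (shade-flip p _ _))
  d₃-free v₂≢v₄ _ (fork _ n s) (fork _ _ s′) (inner (special refl refl)) =
    avoids-d₃-special _ n (λ { refl → v₂≢v₄ refl }) s s′
  d₃-free v₂≢v₄ _ (fork _ _ _) (fork _ _ _) (inner (label _ _)) = v₂≢v₄ refl
  d₃-free _ v₃≢v₄ (fork _ _ _) (fork _ _ _) (inner (label′ _ _)) = v₃≢v₄ refl

  d₄-free : ∀ {v₀ v₁ v₂ v₃ v₄} → v₁ ≢ v₄ → v₂ ≢ v₃ →
            Fork v₀ v₁ v₂ → Fork v₀ v₄ v₃ → Twin v₁ v₃ v₂ v₄ → ⊥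
  -- The vertices v₀, v₂, v₃ share a fibre by the two forks, and cancellation puts v₁ and v₄ into a
  -- second one.
  d₄-free v₁≢v₄ v₂≢v₃ (fork {x} p n s) (fork _ n′ s′) (cross _ _ m s″)
    with cancelˡ x (trans (comm x _) m)
  ... | refl = avoids-d₄ _ n n′ (λ { refl → v₂≢v₃ refl }) (λ { refl → v₁≢v₄ refl }) s s′
                 (trans (sym (shade-flip p _ _)) s″)
  d₄-free _ _ (fork p _ _) (fork _ _ _) (inner _) = p refl

  e₁-free : ∀ {v₀ v₁ v₂ v₃ v₄} → Fork v₀ v₁ v₂ → Twin v₁ v₄ v₀ v₃ → Twin v₂ v₃ v₄ v₀ → ⊥
  e₁-free (fork {x} p _ _) (cross _ _ m _) (cross _ _ m′ _) with cancelˡ x (trans m′ (comm _ x))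
  ... | refl = p (sym (cancelʳ _ m))
  e₁-free (fork _ _ _) (cross _ q _ _) (inner _) = q refl
  e₁-free (fork _ _ _) (inner _) (cross q _ _ _) = q refl
  e₁-free (fork p _ _) (inner _) (inner _) = p refl

  e₂-free : ∀ {v₀ v₁ v₂ v₃ v₄} → v₀ ≢ v₃ → v₂ ≢ v₄ →
            Fork v₀ v₁ v₂ → Twin v₀ v₄ v₁ v₃ → Twin v₂ v₃ v₄ v₁ → ⊥
  -- As v₂ lies in the fibre of v₀, the fibres of v₀, v₄, v₁, v₃ satisfy the equations of pattern
  -- `a`. Hence v₃ and v₄ share a fibre, and cancellation puts v₀ and v₁ together too, against the
  -- fork.
  e₂-free _ _ (fork p _ _) (cross _ _ m _) (cross _ _ m′ _) with rigid-a m (trans (sym m′) (comm _ _))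
  ... | refl = p (cancelʳ _ m)
  e₂-free _ _ (fork p _ _) (cross _ _ _ _) (inner (special _ _)) = p refl
  e₂-free v₀≢v₃ _ (fork p n s) (cross _ _ _ s′) (inner (label i≢j ¬p)) =
    label-e₂′ _ i≢j ¬p n (λ { refl → v₀≢v₃ refl }) (sym s) (trans s′ (shade-flip p _ _))
  e₂-free v₀≢v₃ _ (fork p n s) (cross _ _ _ s′) (inner (label′ i≢j ¬p)) =
    label-e₂ _ i≢j ¬p n (λ { refl → v₀≢v₃ refl }) (sym s) (trans s′ (shade-flip p _ _))
  e₂-free _ _ (fork p _ _) (inner (special _ _)) _ = p refl
  e₂-free _ v₂≢v₄ (fork _ n s) (inner (label i≢j ¬p)) (cross _ _ _ s′) =
    label-e₂ _ i≢j ¬p (n ∘ sym) (λ { refl → v₂≢v₄ refl }) s s′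
  e₂-free _ v₂≢v₄ (fork _ n s) (inner (label′ i≢j ¬p)) (cross _ _ _ s′) =
    label-e₂′ _ i≢j ¬p (n ∘ sym) (λ { refl → v₂≢v₄ refl }) s s′
  e₂-free _ _ (fork p _ _) (inner _) (inner _) = p refl

  f₁-free : ∀ {v₀ v₁ v₂ v₃ v₄} → v₀ ≢ v₂ → v₁ ≢ v₂ → v₁ ≢ v₃ → v₂ ≢ v₃ → v₂ ≢ v₄ →
            Twin v₀ v₁ v₂ v₃ → Twin v₁ v₂ v₃ v₄ → Twin v₁ v₃ v₄ v₀ → ⊥
  -- Here v₁v₃ is itself an edge between fibres, so the collapse x₁ = x₃ is already a contradiction.
  f₁-free _ _ _ _ _ (cross _ _ m _) (cross _ _ m′ _) (cross p _ m″ _) = p (rigid-f₁ m m′ m″)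
  f₁-free _ _ _ _ _ (cross p _ _ _) (cross _ _ _ _) (inner (special _ _)) = p refl
  f₁-free v₀≢v₂ _ _ _ v₂≢v₄ (cross _ _ m s) (cross q _ _ s′) (inner (label i≢j ¬p)) with cancelʳ _ m
  ... | refl = label-f₁′ _ i≢j ¬p (λ { refl → v₂≢v₄ refl }) (λ { refl → v₀≢v₂ refl })
                 (trans (sym (shade-flip q _ _)) (trans s (shade-flip q _ _))) s′
  f₁-free v₀≢v₂ _ _ _ v₂≢v₄ (cross _ _ m s) (cross q _ _ s′) (inner (label′ i≢j ¬p)) with cancelʳ _ m
  ... | refl = label-f₁ _ i≢j ¬p (λ { refl → v₀≢v₂ refl }) (λ { refl → v₂≢v₄ refl })
                 (trans (sym (shade-flip q _ _)) (trans s (shade-flip q _ _))) s′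
  f₁-free _ _ _ _ _ (cross p _ _ _) (inner _) (cross _ _ m _) = p (cancelˡ _ (trans (sym m) (comm _ _)))
  f₁-free _ _ _ _ _ (cross _ p _ _) (inner _) (inner _) = p refl
  f₁-free _ _ _ _ _ (inner _) (cross _ _ m _) (cross _ q _ _) = q (cancelˡ _ (trans (sym m) (comm _ _)))
  f₁-free _ _ _ _ _ (inner _) (cross p _ _ _) (inner _) = p refl
  f₁-free v₀≢v₂ v₁≢v₂ v₁≢v₃ v₂≢v₃ _ t@(inner _) t′@(inner _) _ =
    inner-chain v₀≢v₂ v₁≢v₂ v₁≢v₃ v₂≢v₃ refl refl t t′

  f₂-free : ∀ {v₀ v₁ v₂ v₃ v₄} → v₀ ≢ v₄ → v₀ ≢ v₂ → v₁ ≢ v₂ → v₁ ≢ v₃ → v₂ ≢ v₃ → v₂ ≢ v₄ →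
            Twin v₀ v₁ v₂ v₃ → Twin v₁ v₂ v₃ v₄ → Twin v₁ v₄ v₃ v₀ → ⊥
  -- After x₁ = x₃, cancellation yields x₀ = x₂ = x₄. Over these two fibres the three equations form
  -- a cycle through v₀, v₂, v₄.
  f₂-free v₀≢v₄ v₀≢v₂ _ v₁≢v₃ _ v₂≢v₄ (cross p _ m s) (cross q _ m′ s′) (cross _ _ m″ s″)
    with rigid-f₂ m m′ m″
  ... | refl with cancelʳ _ m | cancelˡ _ m′
  ...   | refl | refl = avoids-f₂ _ (λ { refl → v₁≢v₃ refl }) (λ { refl → v₀≢v₂ refl })
                          (λ { refl → v₀≢v₄ refl })
                          (λ { refl → v₂≢v₄ refl }) s
                          (trans (sym (shade-flip p _ _)) (trans s′ (shade-flip p _ _)))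
                          (trans (sym (shade-flip p _ _)) (trans s″ (shade-flip p _ _)))
  f₂-free _ _ _ _ _ _ (cross _ _ m _) (cross q _ _ _) (inner _) = q (cancelˡ _ (trans m (comm _ _)))
  f₂-free _ _ _ _ _ _ (cross p _ _ _) (inner _) (cross _ _ m _) = p (cancelˡ _ (trans (sym m) (comm _ _)))
  f₂-free _ _ _ _ _ _ (cross _ p _ _) (inner _) (inner _) = p refl
  f₂-free _ _ _ _ _ _ (inner _) (cross _ _ m _) (cross q _ _ _) = q (sym (cancelˡ _ (trans (sym m) (comm _ _))))
  f₂-free _ _ _ _ _ _ (inner _) (cross p _ _ _) (inner _) = p refl
  f₂-free _ v₀≢v₂ v₁≢v₂ v₁≢v₃ v₂≢v₃ _ t@(inner _) t′@(inner _) _ =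
    inner-chain v₀≢v₂ v₁≢v₂ v₁≢v₃ v₂≢v₃ refl refl t t′

  -- Colour classes and triangles: conditions (I) and (II).

  path-ends : ∀ {u v w z} → Fork u v w → Twin u v u z → z ≡ v
  path-ends (fork {x} p n s) (cross _ _ m s′) with cancelˡ x m
  ... | refl = cong (_ ,_) (path-end _ n s (sym s′))
  path-ends (fork p _ _) (inner _) = contradiction refl p

  path-centres : ∀ {u v w z} → Fork u v w → Twin u v v z → z ≡ u ⊎ z ≡ w
  path-centres (fork p n s) (cross {x} {y} _ _ m s′) with cancelˡ y (trans (comm y x) m)
  ... | refl = Sum.map (cong (_ ,_)) (cong (_ ,_)) (path-centre _ n s (sym (trans s′ (shade-flip p _ _))))
  path-centres (fork p _ _) (inner _) = contradiction refl p

  fork-sym : ∀ {u v w} → Fork u v w → Fork w v u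
  fork-sym (fork p n s) = fork p (n ∘ sym) (sym s)

  -- The base of such a triangle joins the two ends of a fork, so it lies within one fibre. Its
  -- colour is special, hence confined to that fibre and absent at the apex, or it is a label, and
  -- `label-II` keeps that label away from the apex.
  triangle-apex : ∀ {u v w z} → Fork u v w → Twin u w v z → ⊥
  triangle-apex (fork _ _ _) (cross p _ _ _) = p refl
  triangle-apex (fork p _ _) (inner (special _ _)) = p refl
  triangle-apex (fork _ _ s) (inner (label i≢j ¬p)) = label-II _ i≢j ¬p s
  triangle-apex (fork _ _ s) (inner (label′ i≢j ¬p)) =
    label-II _ (i≢j ∘ sym) (¬p ∘ partner-sym) (sym s)

  triangle-base : ∀ {u v w z} → Fork u v w → Twin u w u z → z ≡ w
  triangle-base (fork _ _ _) (cross p _ _ _) = contradiction refl p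
  triangle-base (fork _ _ _) (inner (special p q)) = cong (_ ,_) (trans (sym q) p)
  triangle-base (fork _ _ _) (inner (label _ _)) = refl
  triangle-base (fork _ _ _) (inner (label′ i≢j _)) = contradiction refl i≢j

  -- Numbering colours and vertices, and restriction to n vertices.

  palette : ℕ
  palette = P * order + (order + w * w)

  toSum : Colour → (Fin P × Carrier) ⊎ (Carrier ⊎ (W × W))
  toSum (cross γ x) = inj₁ (γ , x)
  toSum (special x) = inj₂ (inj₁ x)
  toSum (label i j) = inj₂ (inj₂ (i , j))

  fromSum : (Fin P × Carrier) ⊎ (Carrier ⊎ (W × W)) → Colour
  fromSum (inj₁ (γ , x))        = cross γ x
  fromSum (inj₂ (inj₁ x))       = special x
  fromSum (inj₂ (inj₂ (i , j))) = label i j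

  fromSum∘toSum : ∀ k → fromSum (toSum k) ≡ k
  fromSum∘toSum (cross _ _) = refl
  fromSum∘toSum (special _) = refl
  fromSum∘toSum (label _ _) = refl

  sum↔ : ((Fin P × Carrier) ⊎ (Carrier ⊎ (W × W))) ↔ Fin palette
  sum↔ = ↔-trans ((↔-trans (↔-refl ×-↔ index) (↔-sym Fin.*↔×)) ⊎-↔
                  (↔-trans (index ⊎-↔ ↔-trans (W↔ ×-↔ W↔) (↔-sym Fin.*↔×)) (↔-sym Fin.+↔⊎)))
                 (↔-sym Fin.+↔⊎)

  vertex↔ : Vertex ↔ Fin (order * w)
  vertex↔ = ↔-trans (index ×-↔ W↔) (↔-sym Fin.*↔×)

  module _ {n} (palette≤n : palette ≤ n) (n≤vertices : n ≤ order * w) where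

    -- Conditions (I) to (III) pass to induced subcolourings, so n of the vertices of the blow-up
    -- are kept.
    ι : Fin n → Vertex
    ι u = Inverse.from vertex↔ (Fin.inject≤ u n≤vertices)

    ι-injective : ∀ {u v} → ι u ≡ ι v → u ≡ v
    ι-injective = Fin.inject≤-injective _ _ _ _ ∘ Injection.injective (↔⇒↣ (↔-sym vertex↔))

    κ : Colour → Fin n
    κ k = Fin.inject≤ (Inverse.to sum↔ (toSum k)) palette≤n

    κ-injective : ∀ {k k′} → κ k ≡ κ k′ → k ≡ k′
    κ-injective {k} {k′} eq =
      trans (sym (fromSum∘toSum k)) (trans (cong fromSum
        (Injection.injective (↔⇒↣ sum↔) (Fin.inject≤-injective palette≤n palette≤n _ _ eq)))
        (fromSum∘toSum k′))

    col : PColouring n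
    col u v = Maybe.map κ (colour (ι u) (ι v))

    col-edge : ∀ u v {γ} → col u v ≡ just γ → ∃ λ k → Edge (ι u) (ι v) k × κ k ≡ γ
    col-edge u v eq with colour (ι u) (ι v) in eq′
    col-edge u v refl | just k = k , edge (ι u) (ι v) eq′ , refl

    twin : ∀ {u v u′ v′ γ} → col u v ≡ just γ → col u′ v′ ≡ just γ →
           Twin (ι u) (ι v) (ι u′) (ι v′)
    twin {u} {v} {u′} {v′} eq eq′ with col-edge u v eq | col-edge u′ v′ eq′
    ... | k , ed , refl | k′ , ed′ , κk′≡κk = twin′ ed ed′ (sym (κ-injective κk′≡κk))

    fork-at : ∀ {u v z γ} → u ≢ z → col u v ≡ just γ → col v z ≡ just γ → Fork (ι u) (ι v) (ι z)
    fork-at u≢z eq eq′ = fork′ (u≢z ∘ ι-injective) (twin eq eq′)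

    col-sym : ∀ u v → col u v ≡ col v u
    col-sym u v = cong (Maybe.map κ) (colour-sym (ι u) (ι v))

    col-total : ∀ {u v} → u ≢ v → col u v ≢ nothing
    col-total {u} {v} u≢v eq with colour-total (ι u) (ι v) (u≢v ∘ ι-injective)
    ... | k , eq′ rewrite eq′ = contradiction eq λ ()

    turn : ∀ {u v γ} → col u v ≡ just γ → col v u ≡ just γ
    turn {u} {v} = trans (col-sym v u)

    well-formed : WellFormed col
    well-formed = col-sym , λ u → cong (Maybe.map κ) (colour-diagonal (ι u))

    classes : ∀ γ → ClassIsEdgesAnd2Paths col γ
    classes γ u v z u≢z uv vz =
      (λ t ut → ι-injective (path-ends uvz (twin uv ut))) ,
      (λ t vt → Sum.map ι-injective ι-injective (path-centres uvz (twin uv vt))) ,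
      (λ t zt → ι-injective (path-ends (fork-sym uvz) (twin (turn vz) zt)))
      where uvz = fork-at u≢z uv vz

    triangles : TriangleProperty col
    triangles u v z γ ℓ _ _ u≢z uv vz uz =
      (λ t vt → triangle-apex uvz (twin uz vt)) ,
      (λ t ut → ι-injective (triangle-base uvz (twin uz ut))) ,
      (λ t zt → ι-injective (triangle-base (fork-sym uvz) (twin (turn uz) zt)))
      where uvz = fork-at u≢z uv vz

    max-degree : MaxDegL col 1 1
    max-degree u []      _ _ = z≤n
    max-degree u (_ ∷ _) _ ((v≢u , eq) ∷ _) = contradiction eq (col-total (v≢u ∘ sym))

    few-completions : FewCompletions col 1 1
    few-completions u v u≢v eq = contradiction eq (col-total u≢v)

    -- An empty completing set leaves no edge to be coloured afterwards, so a copy of a pattern lies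
    -- entirely in the coloured graph.
    solid : ∀ {A B : Set} {C : Fin n × Fin n → Set} → A ⊎ (B × Any C []) → A
    solid (inj₁ x) = x
    solid (inj₂ (_ , ()))

    module Copy {m} {v : Fin m → Fin n} (inj : Injective _≡_ _≡_ v) where
      infix 4 _≁_ _≁′_
      _≁_ : ∀ p q → {False (p Fin.≟ q)} → v p ≢ v q
      _≁_ p q {p≢q} = toWitnessFalse p≢q ∘ inj

      _≁′_ : ∀ p q → {False (p Fin.≟ q)} → ι (v p) ≢ ι (v q)
      _≁′_ p q {p≢q} = (p ≁ q) {p≢q} ∘ ι-injective

    no-bad : NoBadSubgraph col
    no-bad BadType.a (here (v , inj , _ , _ , x₁ ∷ x₂ ∷ y₁ ∷ y₂ ∷ [] , _)) =
      a-free (# 0 ≁′ # 2) (# 1 ≁′ # 2) (# 1 ≁′ # 3) (# 2 ≁′ # 3)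
        (twin (solid x₁) (solid x₂)) (twin (solid y₁) (solid y₂))
      where open Copy inj
    no-bad BadType.b (here (v , inj , _ , _ , x₁ ∷ x₂ ∷ x₃ ∷ y₁ ∷ y₂ ∷ [] , _)) =
      b-free (fork-at (# 0 ≁ # 2) (solid x₁) (solid x₂))
        (twin (solid x₁) (solid x₃)) (twin (solid y₁) (solid y₂))
      where open Copy inj
    no-bad BadType.c (here (v , inj , _ , _ , x₁ ∷ x₂ ∷ y₁ ∷ y₂ ∷ z₁ ∷ z₂ ∷ [] , _)) =
      c-free (fork-at (# 0 ≁ # 2) (solid x₁) (solid x₂))
        (twin (solid y₁) (solid y₂)) (twin (solid z₁) (solid z₂))
      where open Copy inj
    no-bad BadType.d (here (v , inj , _ , _ , x₁ ∷ x₂ ∷ y₁ ∷ y₂ ∷ z₁ ∷ z₂ ∷ [] , _)) =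
      d₁-free (fork-at (# 0 ≁ # 2) (solid x₁) (solid x₂))
        (fork-at (# 1 ≁ # 3) (solid y₁) (turn (solid y₂))) (twin (solid z₁) (solid z₂))
      where open Copy inj
    no-bad BadType.d (there (here (v , inj , _ , _ , x₁ ∷ x₂ ∷ y₁ ∷ y₂ ∷ z₁ ∷ z₂ ∷ [] , _))) =
      d₂-free (fork-at (# 0 ≁ # 2) (solid x₁) (solid x₂))
        (fork-at (# 0 ≁ # 3) (solid y₁) (turn (solid y₂))) (twin (solid z₁) (solid z₂))
      where open Copy inj
    no-bad BadType.d (there (there (here (v , inj , _ , _ , x₁ ∷ x₂ ∷ y₁ ∷ y₂ ∷ z₁ ∷ z₂ ∷ [] , _)))) =
      d₃-free (# 2 ≁′ # 4) (# 3 ≁′ # 4) (fork-at (# 0 ≁ # 2) (solid x₁) (solid x₂))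
        (fork-at (# 4 ≁ # 3) (turn (solid y₁)) (solid y₂)) (twin (solid z₁) (solid z₂))
      where open Copy inj
    no-bad BadType.d (there (there (there (here (v , inj , _ , _ , x₁ ∷ x₂ ∷ y₁ ∷ y₂ ∷ z₁ ∷ z₂ ∷ [] , _))))) =
      d₄-free (# 1 ≁′ # 4) (# 2 ≁′ # 3) (fork-at (# 0 ≁ # 2) (solid x₁) (solid x₂))
        (fork-at (# 0 ≁ # 3) (solid y₁) (solid y₂)) (twin (solid z₁) (solid z₂))
      where open Copy inj
    no-bad BadType.e (here (v , inj , _ , _ , x₁ ∷ x₂ ∷ y₁ ∷ y₂ ∷ z₁ ∷ z₂ ∷ [] , _)) =
      e₁-free (fork-at (# 0 ≁ # 2) (solid x₁) (solid x₂))
        (twin (solid y₁) (solid y₂)) (twin (solid z₁) (solid z₂))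
      where open Copy inj
    no-bad BadType.e (there (here (v , inj , _ , _ , x₁ ∷ x₂ ∷ y₁ ∷ y₂ ∷ z₁ ∷ z₂ ∷ [] , _))) =
      e₂-free (# 0 ≁′ # 3) (# 2 ≁′ # 4) (fork-at (# 0 ≁ # 2) (solid x₁) (solid x₂))
        (twin (solid y₁) (solid y₂)) (twin (solid z₁) (solid z₂))
      where open Copy inj
    no-bad BadType.f (here (v , inj , _ , _ , x₁ ∷ x₂ ∷ y₁ ∷ y₂ ∷ z₁ ∷ z₂ ∷ [] , _)) =
      f₁-free (# 0 ≁′ # 2) (# 1 ≁′ # 2) (# 1 ≁′ # 3) (# 2 ≁′ # 3) (# 2 ≁′ # 4)
        (twin (solid x₁) (solid x₂)) (twin (solid y₁) (solid y₂)) (twin (solid z₁) (solid z₂))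
      where open Copy inj
    no-bad BadType.f (there (here (v , inj , _ , _ , x₁ ∷ x₂ ∷ y₁ ∷ y₂ ∷ z₁ ∷ z₂ ∷ [] , _))) =
      f₂-free (# 0 ≁′ # 4) (# 0 ≁′ # 2) (# 1 ≁′ # 2) (# 1 ≁′ # 3) (# 2 ≁′ # 3) (# 2 ≁′ # 4)
        (twin (solid x₁) (solid x₂)) (twin (solid y₁) (solid y₂)) (twin (solid z₁) (solid z₂))
      where open Copy inj

-- Exhaustive search below a bound and quadratic quasigroups.

all< : ℕ → (ℕ → Bool) → Bool
all< zero    p = true
all< (suc n) p = p n ∧ all< n p

all<-sound : ∀ n p → T (all< n p) → ∀ {i} → i < n → T (p i)
all<-sound (suc n) p t {i} i<1+n with Equivalence.to T-∧ t | m≤n⇒m<n∨m≡n (≤-pred i<1+n)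
... | _  , t′ | inj₁ i<n  = all<-sound n p t′ i<n
... | t′ , _  | inj₂ refl = t′

_∈ˡ_ : ℕ → List ℕ → Bool
d ∈ˡ []       = false
d ∈ˡ (x ∷ xs) = (d ≡ᵇ x) ∨ (d ∈ˡ xs)

≢ᵇ-sound : ∀ m n → T (not (m ≡ᵇ n)) → m ≢ n
≢ᵇ-sound m n t m≡n = Equivalence.to T-not-≡ t ∘′ ≡⇒≡ᵇ m n m≡n
  where
  _∘′_ : ∀ {x} → x ≡ false → T x → ⊥
  refl ∘′ ()

-- The quadratic quasigroup x ∙ y = x + a (y − x) for y − x a square mod q and
-- x ∙ y = y + a (x − y) otherwise, with its left division x \\ (x ∙ y) = y.
module Quadratic (q a a⁻¹ [1-a]⁻¹ : ℕ) .{{_ : NonZero q}} (squares : List ℕ) (flips : Bool) where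

  -- For x < q the sum `y + (q ∸ x)` represents y - x modulo q without truncation. In both instances
  -- 0 is missing from `squares`, so x = y takes the second branch, which gives the idempotence
  -- tested by `check-idem`.
  raw : ℕ → ℕ → ℕ
  raw x y = if ((y + (q ∸ x)) % q) ∈ˡ squares then x + a * (y + (q ∸ x)) else y + a * (x + (q ∸ y))

  _⊙_ : ℕ → ℕ → ℕ
  x ⊙ y = raw x y % q

  -- With t = z - x, the difference y - x is t / a if it is a square and t / (1 - a) otherwise. When
  -- a and 1 - a have the same quadratic character, that of t tells the two cases apart; `flips`
  -- means that both are non-squares.
  divide : ℕ → ℕ → ℕ
  divide x t = (x + (if flips′ (t ∈ˡ squares) then a⁻¹ else [1-a]⁻¹) * t) % q
    where
    flips′ : Bool → Bool
    flips′ s = if flips then not s else s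

  _⑊_ : ℕ → ℕ → ℕ
  x ⑊ z = divide x ((z + (q ∸ x)) % q)

  check-comm check-divide check-idem check-rigid : Bool
  check-comm   = all< q λ x → all< q λ y → (x ⊙ y) ≡ᵇ (y ⊙ x)
  check-divide = all< q λ x → all< q λ y → (x ⑊ (x ⊙ y)) ≡ᵇ y
  check-idem   = all< q λ x → (x ⊙ x) ≡ᵇ x
  -- The first equation of each system gives x₀ by division, and the second equation of pattern `f`
  -- gives x₄. Only x₁, x₂, x₃ need to be enumerated, and the last equation must fail unless x₁ =
  -- x₃.
  check-rigid  = all< q λ x₁ → all< q λ x₂ → all< q λ x₃ → (x₁ ≡ᵇ x₃) ∨
    (λ x₁x₂ x₀ → not (x₁x₂ ≡ᵇ (x₃ ⊙ x₀)) ∧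
      (λ x₄ → not ((x₁ ⊙ x₃) ≡ᵇ (x₄ ⊙ x₀)) ∧ not ((x₁ ⊙ x₄) ≡ᵇ (x₃ ⊙ x₀))) (x₃ ⑊ x₁x₂))
    (x₁ ⊙ x₂) (x₁ ⑊ (x₂ ⊙ x₃))

  module Checked (ok-comm : T check-comm) (ok-divide : T check-divide)
                 (ok-idem : T check-idem) (ok-rigid : T check-rigid) where

    ⊙-comm : ∀ {x y} → x < q → y < q → x ⊙ y ≡ y ⊙ x
    ⊙-comm x< y< = ≡ᵇ⇒≡ _ _ (all<-sound q _ (all<-sound q _ ok-comm x<) y<)

    ⊙-divide : ∀ {x y} → x < q → y < q → x ⑊ (x ⊙ y) ≡ y
    ⊙-divide x< y< = ≡ᵇ⇒≡ _ _ (all<-sound q _ (all<-sound q _ ok-divide x<) y<)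

    ⊙-idem : ∀ {x} → x < q → x ⊙ x ≡ x
    ⊙-idem x< = ≡ᵇ⇒≡ _ _ (all<-sound q _ ok-idem x<)

    ⊙-rigid : ∀ {x₁ x₂ x₃} → x₁ < q → x₂ < q → x₃ < q →
              let x₀ = x₁ ⑊ (x₂ ⊙ x₃) ; x₄ = x₃ ⑊ (x₁ ⊙ x₂) in
              x₁ ≡ x₃ ⊎ (x₁ ⊙ x₂ ≢ x₃ ⊙ x₀ × x₁ ⊙ x₃ ≢ x₄ ⊙ x₀ × x₁ ⊙ x₄ ≢ x₃ ⊙ x₀)
    ⊙-rigid {x₁} {x₂} {x₃} x₁< x₂< x₃<
      with Equivalence.to (T-∨ {x₁ ≡ᵇ x₃}) (all<-sound q _ (all<-sound q _ (all<-sound q _ ok-rigid x₁<) x₂<) x₃<)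
    ... | inj₁ t = inj₁ (≡ᵇ⇒≡ _ _ t)
    ... | inj₂ t with Equivalence.to T-∧ t
    ...   | t₁ , t₂ with Equivalence.to T-∧ t₂
    ...     | t₂ , t₃ = inj₂ (≢ᵇ-sound _ _ t₁ , ≢ᵇ-sound _ _ t₂ , ≢ᵇ-sound _ _ t₃)

    _·_ : Fin q → Fin q → Fin q
    x · y = fromℕ< (m%n<n (raw (toℕ x) (toℕ y)) q)

    toℕ-· : ∀ x y → toℕ (x · y) ≡ toℕ x ⊙ toℕ y
    toℕ-· x y = Fin.toℕ-fromℕ< (m%n<n (raw (toℕ x) (toℕ y)) q)

    lift : ∀ x y z t → x · y ≡ z · t → toℕ x ⊙ toℕ y ≡ toℕ z ⊙ toℕ t
    lift x y z t eq = trans (sym (toℕ-· x y)) (trans (cong toℕ eq) (toℕ-· z t))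

    solve : ∀ x y z t → x · y ≡ z · t → toℕ y ⑊ (toℕ z ⊙ toℕ t) ≡ toℕ x
    solve x y z t eq = trans (cong (toℕ y ⑊_) (trans (sym (lift x y z t eq)) (⊙-comm (Fin.toℕ<n x) (Fin.toℕ<n y))))
                             (⊙-divide (Fin.toℕ<n y) (Fin.toℕ<n x))

    quadratic : RigidQuasigroup
    quadratic = record
      { Carrier    = Fin q
      ; order      = q
      ; index      = ↔-refl
      ; _∙_        = _·_
      ; comm       = λ x y → Fin.toℕ-injective
          (trans (toℕ-· x y) (trans (⊙-comm (Fin.toℕ<n x) (Fin.toℕ<n y)) (sym (toℕ-· y x))))
      ; cancelˡ    = λ x {y} {z} eq → Fin.toℕ-injective
          (trans (sym (⊙-divide (Fin.toℕ<n x) (Fin.toℕ<n y)))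
            (trans (cong (toℕ x ⑊_) (lift x y x z eq)) (⊙-divide (Fin.toℕ<n x) (Fin.toℕ<n z))))
      ; square-inj = λ {x} {y} eq → Fin.toℕ-injective
          (trans (sym (⊙-idem (Fin.toℕ<n x))) (trans (lift x x y y eq) (⊙-idem (Fin.toℕ<n y))))
      ; rigid-a    = λ {x₀} {x₁} {x₂} {x₃} → λ eq eq′ →
          by x₁ x₂ x₃ λ (a-free , _) → a-free
            (trans (lift x₁ x₂ x₃ x₀ eq′) (cong (toℕ x₃ ⊙_) (sym (solve x₀ x₁ x₂ x₃ eq))))
      ; rigid-f₁   = λ {x₀} {x₁} {x₂} {x₃} {x₄} → λ eq eq′ eq″ →
          by x₁ x₂ x₃ λ (_ , f₁-free , _) → f₁-free
            (trans (lift x₁ x₃ x₄ x₀ eq″)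
              (sym (cong₂ _⊙_ (solve₄ x₁ x₂ x₃ x₄ eq′) (solve x₀ x₁ x₂ x₃ eq))))
      ; rigid-f₂   = λ {x₀} {x₁} {x₂} {x₃} {x₄} → λ eq eq′ eq″ →
          by x₁ x₂ x₃ λ (_ , _ , f₂-free) → f₂-free
            (trans (cong (toℕ x₁ ⊙_) (solve₄ x₁ x₂ x₃ x₄ eq′))
              (trans (lift x₁ x₄ x₃ x₀ eq″) (cong (toℕ x₃ ⊙_) (sym (solve x₀ x₁ x₂ x₃ eq)))))
      }
      where
      solve₄ : ∀ x₁ x₂ x₃ x₄ → x₁ · x₂ ≡ x₃ · x₄ → toℕ x₃ ⑊ (toℕ x₁ ⊙ toℕ x₂) ≡ toℕ x₄
      solve₄ x₁ x₂ x₃ x₄ eq = trans (cong (toℕ x₃ ⑊_) (lift x₁ x₂ x₃ x₄ eq)) (⊙-divide (Fin.toℕ<n x₃) (Fin.toℕ<n x₄))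
      by : ∀ x₁ x₂ x₃ →
           (let x₀ = toℕ x₁ ⑊ (toℕ x₂ ⊙ toℕ x₃) ; x₄ = toℕ x₃ ⑊ (toℕ x₁ ⊙ toℕ x₂) in
            (toℕ x₁ ⊙ toℕ x₂ ≢ toℕ x₃ ⊙ x₀ × toℕ x₁ ⊙ toℕ x₃ ≢ x₄ ⊙ x₀ × toℕ x₁ ⊙ x₄ ≢ toℕ x₃ ⊙ x₀) → ⊥) →
           x₁ ≡ x₃
      by x₁ x₂ x₃ ¬free with ⊙-rigid (Fin.toℕ<n x₁) (Fin.toℕ<n x₂) (Fin.toℕ<n x₃)
      ... | inj₁ eq   = Fin.toℕ-injective eq
      ... | inj₂ free = ⊥-elim (¬free free)

-- Products and powers of rigid quasigroups.

_⊗_ : RigidQuasigroup → RigidQuasigroup → RigidQuasigroup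
Q ⊗ R = record
  { Carrier    = Q.Carrier × R.Carrier
  ; order      = Q.order * R.order
  ; index      = ↔-trans (Q.index ×-↔ R.index) (↔-sym Fin.*↔×)
  ; _∙_        = λ (x , y) (x′ , y′) → x Q.∙ x′ , y R.∙ y′
  ; comm       = λ (x , y) (x′ , y′) → cong₂ _,_ (Q.comm x x′) (R.comm y y′)
  -- This axiom and the following ones are implications from equations to an equation, so they hold
  -- coordinatewise.
  ; cancelˡ    = λ (x , y) eq → ×-≡ (Q.cancelˡ x (cong proj₁ eq)) (R.cancelˡ y (cong proj₂ eq))
  ; square-inj = λ eq → ×-≡ (Q.square-inj (cong proj₁ eq)) (R.square-inj (cong proj₂ eq))
  ; rigid-a    = λ eq eq′ → ×-≡ (Q.rigid-a (cong proj₁ eq) (cong proj₁ eq′))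
                                (R.rigid-a (cong proj₂ eq) (cong proj₂ eq′))
  ; rigid-f₁   = λ eq eq′ eq″ → ×-≡ (Q.rigid-f₁ (cong proj₁ eq) (cong proj₁ eq′) (cong proj₁ eq″))
                                    (R.rigid-f₁ (cong proj₂ eq) (cong proj₂ eq′) (cong proj₂ eq″))
  ; rigid-f₂   = λ eq eq′ eq″ → ×-≡ (Q.rigid-f₂ (cong proj₁ eq) (cong proj₁ eq′) (cong proj₁ eq″))
                                    (R.rigid-f₂ (cong proj₂ eq) (cong proj₂ eq′) (cong proj₂ eq″))
  }
  where
  module Q = RigidQuasigroup Q
  module R = RigidQuasigroup R
  ×-≡ : ∀ {u v : Q.Carrier × R.Carrier} → proj₁ u ≡ proj₁ v → proj₂ u ≡ proj₂ v → u ≡ v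
  ×-≡ = cong₂ _,_

singleton : RigidQuasigroup
singleton = record
  { Carrier = ⊤ ; order = 1 ; index = ↔-sym Fin.1↔⊤ ; _∙_ = λ _ _ → tt ; comm = λ _ _ → refl
  ; cancelˡ = λ _ _ → refl ; square-inj = λ _ → refl ; rigid-a = λ _ _ → refl
  ; rigid-f₁ = λ _ _ _ → refl ; rigid-f₂ = λ _ _ _ → refl }

power : RigidQuasigroup → ℕ → RigidQuasigroup
power Q zero    = singleton
power Q (suc k) = Q ⊗ power Q k

order-power : ∀ Q k → RigidQuasigroup.order (power Q k) ≡ RigidQuasigroup.order Q ^ k
order-power Q zero    = refl
order-power Q (suc k) = cong (RigidQuasigroup.order Q *_) (order-power Q k)

-- Both primes are 3 modulo 4, so for x ≠ y exactly one of y - x and x - y is a square and the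
-- product is commutative. For a = 2 modulo 11 both 2 and -1 are non-squares; for a = 6 modulo 23
-- both 6 and -5 are squares.
order-11 order-23 : RigidQuasigroup
order-11 = Quadratic.Checked.quadratic 11 2 6 10 (1 ∷ 3 ∷ 4 ∷ 5 ∷ 9 ∷ []) true tt tt tt tt
order-23 = Quadratic.Checked.quadratic 23 6 4 9 (1 ∷ 2 ∷ 3 ∷ 4 ∷ 6 ∷ 8 ∷ 9 ∷ 12 ∷ 13 ∷ 16 ∷ 18 ∷ []) false tt tt tt tt

-- Tables indexed by the 64 types, in a form suited to evaluation.

data Digit : Set where
  d₀ d₁ d₂ d₃ : Digit

-- A number below 64 by its three base-4 digits. Lookup and comparison then reduce to a few
-- constructor matches.
data Point : Set where
  pt : Digit → Digit → Digit → Point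

data Quad (A : Set) : Set where
  quad : A → A → A → A → Quad A

pick : ∀ {A} → Quad A → Digit → A
pick (quad x _ _ _) d₀ = x
pick (quad _ x _ _) d₁ = x
pick (quad _ _ x _) d₂ = x
pick (quad _ _ _ x) d₃ = x

alter : ∀ {A} → (A → A) → Digit → Quad A → Quad A
alter h d₀ (quad x y z t) = quad (h x) y z t
alter h d₁ (quad x y z t) = quad x (h y) z t
alter h d₂ (quad x y z t) = quad x y (h z) t
alter h d₃ (quad x y z t) = quad x y z (h t)

fill : ∀ {A} → (Digit → A) → Quad A
fill h = quad (h d₀) (h d₁) (h d₂) (h d₃)

Trie : Set → Set
Trie A = Quad (Quad (Quad A))

infixl 9 _!_
_!_ : ∀ {A} → Trie A → Point → A
m ! pt x y z = pick (pick (pick m x) y) z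

tabulate : ∀ {A} → (Point → A) → Trie A
tabulate h = fill λ x → fill λ y → fill λ z → h (pt x y z)

update : ∀ {A} → (A → A) → Point → Trie A → Trie A
update h (pt x y z) = alter (alter (alter h z) y) x

every₄ : (Digit → Bool) → Bool
every₄ q = q d₀ ∧ q d₁ ∧ q d₂ ∧ q d₃

∧-elimˡ : ∀ {x y} → T (x ∧ y) → T x
∧-elimˡ {true} _ = tt

∧-elimʳ : ∀ {x y} → T (x ∧ y) → T y
∧-elimʳ {true} t = t

every₄-sound : ∀ q → T (every₄ q) → ∀ x → T (q x)
every₄-sound q t d₀ = ∧-elimˡ t
every₄-sound q t d₁ = ∧-elimˡ (∧-elimʳ {q d₀} t)
every₄-sound q t d₂ = ∧-elimˡ (∧-elimʳ {q d₁} (∧-elimʳ {q d₀} t))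
every₄-sound q t d₃ = ∧-elimʳ {q d₂} (∧-elimʳ {q d₁} (∧-elimʳ {q d₀} t))

everywhere : (Point → Bool) → Bool
everywhere q = every₄ λ x → every₄ λ y → every₄ λ z → q (pt x y z)

everywhere-sound : ∀ q → T (everywhere q) → ∀ i → T (q i)
everywhere-sound q t (pt x y z) =
  every₄-sound (λ z → q (pt x y z))
    (every₄-sound (λ y → every₄ λ z → q (pt x y z))
      (every₄-sound (λ x → every₄ λ y → every₄ λ z → q (pt x y z)) t x) y) z

every : ∀ {A : Set} → (A → Bool) → List A → Bool
every q []       = true
every q (x ∷ xs) = q x ∧ every q xs

infix 4 _≈_ _==_ _∈ᵇ_

_≈_ : Digit → Digit → Bool
d₀ ≈ d₀ = true
d₁ ≈ d₁ = true
d₂ ≈ d₂ = true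
d₃ ≈ d₃ = true
_  ≈ _  = false

_==_ : Point → Point → Bool
pt x y z == pt x′ y′ z′ = (z ≈ z′) ∧ (y ≈ y′) ∧ (x ≈ x′)

≈-sound : ∀ x y → T (x ≈ y) → x ≡ y
≈-sound d₀ d₀ _ = refl
≈-sound d₁ d₁ _ = refl
≈-sound d₂ d₂ _ = refl
≈-sound d₃ d₃ _ = refl

≈-refl : ∀ x → T (x ≈ x)
≈-refl d₀ = tt
≈-refl d₁ = tt
≈-refl d₂ = tt
≈-refl d₃ = tt

==-sound : ∀ i j → T (i == j) → i ≡ j
==-sound (pt x y z) (pt x′ y′ z′) t
  with ≈-sound z z′ (∧-elimˡ t) | ≈-sound y y′ (∧-elimˡ (∧-elimʳ {z ≈ z′} t))
     | ≈-sound x x′ (∧-elimʳ {y ≈ y′} (∧-elimʳ {z ≈ z′} t))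
... | refl | refl | refl = refl

_∈ᵇ_ : Point → List Point → Bool
i ∈ᵇ []       = false
i ∈ᵇ (j ∷ js) = (i == j) ∨ (i ∈ᵇ js)

quads : ∀ {A} → List A → List (Quad A)
quads (x ∷ y ∷ z ∷ t ∷ xs) = quad x y z t ∷ quads xs
quads _                    = []

trie : ∀ {A} → A → List A → Trie A
trie z xs with quads (quads (quads xs))
-- This default arises only for fewer than 64 entries.
... | []    = tabulate (λ _ → z)
... | m ∷ _ = m

digit : ℕ → Digit
digit 0 = d₀
digit 1 = d₁
digit 2 = d₂
digit _ = d₃

point : ℕ → Point
point n = pt (digit (n / 16)) (digit (n / 4 % 4)) (digit (n % 4))

value : Digit → ℕ
value d₀ = 0
value d₁ = 1
value d₂ = 2
value d₃ = 3

code : Point → ℕ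
code (pt x y z) = 16 * value x + (4 * value y + value z)

digits : ℕ → ℕ → List ℕ
digits zero    n = []
digits (suc k) n = n % 100 ∷ digits k (n / 100)

row : ℕ → Trie Point
row n = trie (point 0) (map point (digits 64 n))

Table : Set
Table = Trie (Trie Point)

transpose : Table → Table
transpose U = tabulate λ i → tabulate λ j → U ! j ! i

points : List Point
points = map point (go 64 0)
  where
  go : ℕ → ℕ → List ℕ
  go zero    _ = []
  go (suc k) n = n ∷ go k (suc n)

-- Sorting the ends by symbol lets the tests run through the coincidences of symbols instead of
-- through all pairs of ends.
invert : Trie Point → Trie (List Point)
invert u = go points
  where
  go : List Point → Trie (List Point)
  go []       = tabulate (λ _ → [])
  go (i ∷ is) = update (i ∷_) (u ! i) (go is)

EndTable : Set
EndTable = Trie (Trie (List Point))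

inverse : Table → EndTable
inverse U = tabulate λ i → invert (U ! i)


-- The finite tests on the array.

-- e c r is the symbol joining the centre c to the end r, and N c k lists the ends that c joins by k
module Tests (P : ℕ) .{{_ : NonZero P}} (π : Point → Point) where

  Entries Ends : Set
  Entries = Point → Point → Point
  Ends    = Point → Point → List Point

  unlabelled : Point → Point → Bool
  unlabelled i j = (i == j) ∨ (π i == j)

  module _ (e : Entries) (N : Ends) where

    -- `complete` guarantees that a search through the lists of `N` misses no coincidence. `valid`
    -- keeps every symbol below `P`, so that reduction modulo `P` loses nothing.
    complete valid twins labels : Bool
    complete = everywhere λ c → everywhere λ r → r ∈ᵇ N c (e c r)

    valid = everywhere λ c → everywhere λ r → point (code (e c r) % P) == e c r

    -- Let r → s mean that `e c r` equals `e d s`; the list `W ! r` contains these s. Over two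
    -- fibres, pattern `a` is a 2-cycle of this relation and the second pattern `f` a 3-cycle, and
    -- the search follows the lists to find neither.
    twin : Point → Point → Bool
    twin c d =
      (λ W → everywhere λ r → every (λ s → (r == s) ∨ every (λ t → not (r == t) ∧
               ((s == t) ∨ every (λ q → not (r == q)) (W ! t))) (W ! s)) (W ! r))
      (tabulate λ r → N d (e c r))

    -- Exchanging c and d reverses the relation and preserves its cycles, so one order of each pair
    -- is enough.
    twins = everywhere λ c → everywhere λ d → not (code c <ᵇ code d) ∨ twin c d

    forks : (Point → Point → Point → Bool) → Bool
    forks q = everywhere λ c → everywhere λ r → every (λ s → (r == s) ∨ q c r s) (N c (e c r))

    centre-at : Point → Point → Point → Bool
    centre-at r s t = (t == r) ∨ (t == s)

    d₄-inner : Point → Point → Point → Point → Point → Bool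
    d₄-inner c r s d t = (r == t) ∨ (s == t) ∨ not (e c t == e d s)

    end-at d₄-at : Point → Point → Point → Point → Bool
    end-at c r s d = (d == c) ∨ not (e d r == e c r)
    d₄-at  c r s d = (c == d) ∨ every (d₄-inner c r s d) (N d (e d r))

    d₂-at e₂-at d₂′-ok e₂′-ok special-ok fork-ok : Point → Point → Point → Bool
    d₂-at c r j = unlabelled c j ∨ (r == j) ∨ not (e j r == e j j)
    e₂-at c s j = unlabelled c j ∨ (s == j) ∨ not (e j s == e c j)
    d₂′-ok c r s = unlabelled c s ∨ (r == c) ∨ not (e s r == e s c)
    e₂′-ok c r s = unlabelled r c ∨ (s == c) ∨ not (e r s == e c c)
    special-ok c r s = (s == π r) ∨ not (e c (π r) == e c (π s))
    -- The guarded conjuncts concern forks with one end of the same type as the centre, the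
    -- situation of `label-d₂`, `label-e₂` and `label-II`.
    fork-ok c r s = every (centre-at r s) (N c (e c r)) ∧ everywhere (end-at c r s) ∧
                    everywhere (d₄-at c r s) ∧ (not (s == c) ∨ everywhere (d₂-at c r)) ∧ d₂′-ok c r s ∧
                    (not (r == c) ∨ everywhere (e₂-at c s)) ∧ e₂′-ok c r s ∧
                    (not (r == c) ∨ (π c == s)) ∧ special-ok c r s

    f₁-at f₁′-at : Point → Point → Point → Bool
    f₁-at  i j k = unlabelled i k ∨ (j == i) ∨ (j == k) ∨ not (e j i == e k k)
    f₁′-at i j k = unlabelled k i ∨ (j == k) ∨ (j == i) ∨ not (e j k == e k i)

    label-ok : Point → Point → Bool
    label-ok i j = (unlabelled i j ∨ not (e j i == e i j)) ∧ (unlabelled i j ∨ not (e i i == e j j)) ∧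
                   every (f₁-at i j) (N j (e i i)) ∧ every (f₁′-at i j) (N i (e j i))

    labels = everywhere λ i → everywhere λ j → label-ok i j

    single : Bool
    single = complete ∧ valid ∧ twins ∧ forks fork-ok ∧ labels

    -- The third pattern `d`: two forks with the same centre type, read in the tables `e` and `e′`,
    -- whose ends are joined crosswise by equal symbols of `x`.
    double : Entries → Ends → Entries → Bool
    double e′ N′ x = forks λ c r s → everywhere λ y →
      every (λ z → (y == z) ∨ not (x z s == x y r)) (N′ c (e′ c y))

  points-ok : Bool
  points-ok = everywhere λ i → (π (π i) == i) ∧ (point (code i) == i)

  doubles : Entries → Ends → Entries → Ends → Entries → Entries → Bool
  doubles e N e′ N′ x y = double e N e′ N′ x ∧ double e N e′ N′ y

  checks : Entries → Entries → Ends → Ends → Bool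
  checks e e′ N N′ = points-ok ∧ single e N ∧ single e′ N′ ∧
    double e N e N e ∧ doubles e N e′ N′ e e′ ∧ double e′ N′ e′ N′ e′

-- Applying k through λ-abstractions makes the evaluator compute the three auxiliary tables only once.
shared : ∀ {A : Set} → (Table → Table → EndTable → EndTable → A) → Table → A
shared k U = (λ V → k U V (inverse U) (inverse V)) (transpose U)

Lookups : Set
Lookups = (Point → Point → Point) × (Point → Point → Point) ×
          (Point → Point → List Point) × (Point → Point → List Point)

lookups : Table → Table → EndTable → EndTable → Lookups
lookups U V I J = (λ c r → U ! c ! r) , (λ c r → V ! c ! r) , (λ c k → I ! c ! k) , (λ c k → J ! c ! k)

suite : (ℕ × (Point → Point)) × Lookups → Bool
suite ((m , π) , e , e′ , N , N′) = Tests.checks (suc m) π e e′ N N′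

-- Unlike T (q x), this type is compared argument by argument: the checker must never unfold the tests.
record Holds {A : Set} (q : A → Bool) (x : A) : Set where
  constructor holds
  field evidence : T (q x)

-- Soundness of the tests.

pick-fill : ∀ {A} (h : Digit → A) x → pick (fill h) x ≡ h x
pick-fill h d₀ = refl
pick-fill h d₁ = refl
pick-fill h d₂ = refl
pick-fill h d₃ = refl

tabulate-! : ∀ {A} (h : Point → A) i → tabulate h ! i ≡ h i
tabulate-! h (pt x y z)
  rewrite pick-fill (λ x → fill λ y → fill λ z → h (pt x y z)) x
        | pick-fill (λ y → fill λ z → h (pt x y z)) y
        = pick-fill (λ z → h (pt x y z)) z

∨-skip : ∀ i j {b} → T ((i == j) ∨ b) → i ≢ j → T b
∨-skip i j t i≢j with i == j in eq
... | true  = contradiction (==-sound i j (subst T (sym eq) tt)) i≢j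
... | false = t

∧-intro : ∀ {x y} → T x → T y → T (x ∧ y)
∧-intro {true} _ t = t

==-refl : ∀ i → T (i == i)
==-refl (pt x y z) = ∧-intro (≈-refl z) (∧-intro (≈-refl y) (≈-refl x))

_≟_ : ∀ (i j : Point) → Dec (i ≡ j)
i ≟ j with i == j in eq
... | true  = yes (==-sound i j (subst T (sym eq) tt))
... | false = no λ { refl → subst T eq (==-refl i) }

either : ∀ t r s → T ((t == r) ∨ (t == s)) → t ≡ r ⊎ t ≡ s
either t r s h with t == r in eq
... | true  = inj₁ (==-sound t r (subst T (sym eq) tt))
... | false = inj₂ (==-sound t s h)

∧-elim : ∀ x y → T (x ∧ y) → T x × T y
∧-elim true y t = tt , t

everywhere²-sound : ∀ (q : Point → Point → Bool) →
                    T (everywhere λ i → everywhere λ j → q i j) → ∀ i j → T (q i j)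
everywhere²-sound q t i = everywhere-sound (q i) (everywhere-sound (λ i → everywhere (q i)) t i)

not-∨ : ∀ b {x} → T (not b ∨ x) → T b → T x
not-∨ true t _ = t

refute : ∀ i j → T (not (i == j)) → i ≢ j
refute i _ t refl with i == i | ==-refl i
... | true | _ = t

every-∈ : ∀ q js {i} → T (every q js) → T (i ∈ᵇ js) → T (q i)
every-∈ q (j ∷ js) {i} t m with i == j in eq
... | true  rewrite ==-sound i j (subst T (sym eq) tt) = ∧-elimˡ t
... | false = every-∈ q js (∧-elimʳ {q j} t) m

module _ (P : ℕ) .{{_ : NonZero P}} (π : Point → Point) where
  open Tests P π

  unlabelled-skip : ∀ i j {b} → T (unlabelled i j ∨ b) → i ≢ j → π i ≢ j → T b
  unlabelled-skip i j t i≢j ¬p with i == j in eq | π i == j in eq′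
  ... | true  | _     = contradiction (==-sound i j (subst T (sym eq) tt)) i≢j
  ... | false | true  = contradiction (==-sound (π i) j (subst T (sym eq′) tt)) ¬p
  ... | false | false = t

  module SingleFacts (e : Entries) (N : Ends) (ok : T (single e N)) where

    private
      s₁ = ∧-elim (complete e N) (valid e N ∧ twins e N ∧ forks e N (fork-ok e N) ∧ labels e N) ok
      s₂ = ∧-elim (valid e N) (twins e N ∧ forks e N (fork-ok e N) ∧ labels e N) (proj₂ s₁)
      s₃ = ∧-elim (twins e N) (forks e N (fork-ok e N) ∧ labels e N) (proj₂ s₂)
      s₄ = ∧-elim (forks e N (fork-ok e N)) (labels e N) (proj₂ s₃)

    member : ∀ c d r s → e c r ≡ e d s → T (s ∈ᵇ (N d (e c r)))
    member c d r s m = subst (λ k → T (s ∈ᵇ (N d k))) (sym m)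
      (everywhere²-sound (λ c r → r ∈ᵇ (N c (e c r))) (proj₁ s₁) d s)

    symbol : ∀ c r → point (code (e c r) % P) ≡ e c r
    symbol c r = ==-sound (point (code (e c r) % P)) (e c r)
      (everywhere²-sound (λ c r → point (code (e c r) % P) == e c r) (proj₁ s₂) c r)

    forks-sound : ∀ q → T (forks e N q) → ∀ c r s → r ≢ s → e c r ≡ e c s → T (q c r s)
    forks-sound q t c r s r≢s m =
      ∨-skip r s (every-∈ (λ s → (r == s) ∨ q c r s) (N c (e c r))
        (everywhere²-sound (λ c r → every (λ s → (r == s) ∨ q c r s) (N c (e c r))) t c r)
        (member c c r s m)) r≢s

    twin-sound : ∀ {c d} → T (twin e N c d) → ∀ {r s} → r ≢ s → e c r ≡ e d s →
                 e c s ≢ e d r ×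
                 (∀ {t} → s ≢ t → e c s ≡ e d t → e c t ≢ e d r)
    twin-sound {c} {d} ok {r} {s} r≢s m =
      (λ m′ → refute r r (proj₁ (step r m′)) refl) ,
      (λ {t} s≢t m′ m″ → refute r r (every-∈ (λ q → not (r == q)) (W ! t)
        (∨-skip s t (proj₂ (step t m′)) s≢t) (W-∈ t r m″)) refl)
      where
      W : Trie (List Point)
      W = tabulate λ r → N d (e c r)
      inmost : Point → Point → Bool
      inmost s t = not (r == t) ∧ ((s == t) ∨ every (λ q → not (r == q)) (W ! t))
      middle : Point → Point → Bool
      middle r s = (r == s) ∨ every (λ t → not (r == t) ∧ ((s == t) ∨ every (λ q → not (r == q)) (W ! t))) (W ! s)
      W-∈ : ∀ r s → e c r ≡ e d s → T (s ∈ᵇ (W ! r))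
      W-∈ r s m = subst (λ l → T (s ∈ᵇ l)) (sym (tabulate-! (λ r → N d (e c r)) r)) (member c d r s m)
      step : ∀ t → e c s ≡ e d t →
             T (not (r == t)) × T ((s == t) ∨ every (λ q → not (r == q)) (W ! t))
      step t m′ = ∧-elim (not (r == t)) _ (every-∈ (inmost s) (W ! s)
        (∨-skip r s (every-∈ (middle r) (W ! r) (everywhere-sound (λ r → every (middle r) (W ! r)) ok r) (W-∈ r s m)) r≢s)
        (W-∈ s t m′))

    twins-sound : ∀ {c d} → code c < code d → T (twin e N c d)
    twins-sound {c} {d} c<d = not-∨ (code c <ᵇ code d)
      (everywhere²-sound (λ c d → not (code c <ᵇ code d) ∨ twin e N c d) (proj₁ s₃) c d) (<⇒<ᵇ c<d)

    module Fork {c r s} (r≢s : r ≢ s) (m : e c r ≡ e c s) where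
      private
        f₁ = ∧-elim (every (centre-at e N r s) (N c (e c r)))
               (everywhere (end-at e N c r s) ∧ everywhere (d₄-at e N c r s) ∧ (not (s == c) ∨ everywhere (d₂-at e N c r)) ∧ d₂′-ok e N c r s ∧ (not (r == c) ∨ everywhere (e₂-at e N c s)) ∧ e₂′-ok e N c r s ∧ (not (r == c) ∨ (π c == s)) ∧ special-ok e N c r s)
               (forks-sound (fork-ok e N) (proj₁ s₄) c r s r≢s m)
        f₂ = ∧-elim (everywhere (end-at e N c r s))
               (everywhere (d₄-at e N c r s) ∧ (not (s == c) ∨ everywhere (d₂-at e N c r)) ∧ d₂′-ok e N c r s ∧ (not (r == c) ∨ everywhere (e₂-at e N c s)) ∧ e₂′-ok e N c r s ∧ (not (r == c) ∨ (π c == s)) ∧ special-ok e N c r s)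
               (proj₂ f₁)
        f₃ = ∧-elim (everywhere (d₄-at e N c r s))
               ((not (s == c) ∨ everywhere (d₂-at e N c r)) ∧ d₂′-ok e N c r s ∧ (not (r == c) ∨ everywhere (e₂-at e N c s)) ∧ e₂′-ok e N c r s ∧ (not (r == c) ∨ (π c == s)) ∧ special-ok e N c r s)
               (proj₂ f₂)
        f₄ = ∧-elim (not (s == c) ∨ everywhere (d₂-at e N c r))
               (d₂′-ok e N c r s ∧ (not (r == c) ∨ everywhere (e₂-at e N c s)) ∧ e₂′-ok e N c r s ∧ (not (r == c) ∨ (π c == s)) ∧ special-ok e N c r s)
               (proj₂ f₃)
        f₅ = ∧-elim (d₂′-ok e N c r s)
               ((not (r == c) ∨ everywhere (e₂-at e N c s)) ∧ e₂′-ok e N c r s ∧ (not (r == c) ∨ (π c == s)) ∧ special-ok e N c r s)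
               (proj₂ f₄)
        f₆ = ∧-elim (not (r == c) ∨ everywhere (e₂-at e N c s))
               (e₂′-ok e N c r s ∧ (not (r == c) ∨ (π c == s)) ∧ special-ok e N c r s)
               (proj₂ f₅)
        f₇ = ∧-elim (e₂′-ok e N c r s)
               ((not (r == c) ∨ (π c == s)) ∧ special-ok e N c r s)
               (proj₂ f₆)
        f₈ = ∧-elim (not (r == c) ∨ (π c == s))
               (special-ok e N c r s)
               (proj₂ f₇)

      centre : ∀ t → e c r ≡ e c t → t ≡ r ⊎ t ≡ s
      centre t m′ = either t r s (every-∈ (centre-at e N r s) (N c (e c r)) (proj₁ f₁) (member c c r t m′))

      end : ∀ d → d ≢ c → e d r ≢ e c r
      end d d≢c = refute _ _ (∨-skip d c (everywhere-sound (end-at e N c r s) (proj₁ f₂) d) d≢c)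

      no-d₄ : ∀ {d t} → c ≢ d → r ≢ t → s ≢ t → e d r ≡ e d t → e c t ≢ e d s
      no-d₄ {d} {t} c≢d r≢t s≢t m′ = refute _ _ (∨-skip s t (∨-skip r t
        (every-∈ (d₄-inner e N c r s d) (N d (e d r))
          (∨-skip c d (everywhere-sound (d₄-at e N c r s) (proj₁ f₃) d) c≢d) (member d d r t m′)) r≢t) s≢t)

      no-d₂ : s ≡ c → ∀ {j} → c ≢ j → π c ≢ j → r ≢ j → e j r ≢ e j j
      no-d₂ refl {j} c≢j ¬p r≢j = refute _ _ (∨-skip r j (unlabelled-skip c j
        (everywhere-sound (d₂-at e N c r)
          (not-∨ (s == c) (proj₁ f₄) (==-refl s)) j) c≢j ¬p) r≢j)

      no-d₂′ : c ≢ s → π c ≢ s → r ≢ c → e s r ≢ e s c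
      no-d₂′ c≢s ¬p r≢c = refute _ _ (∨-skip r c (unlabelled-skip c s (proj₁ f₅) c≢s ¬p) r≢c)

      no-e₂ : r ≡ c → ∀ {j} → c ≢ j → π c ≢ j → s ≢ j → e j s ≢ e c j
      no-e₂ refl {j} c≢j ¬p s≢j = refute _ _ (∨-skip s j (unlabelled-skip c j
        (everywhere-sound (e₂-at e N c s)
          (not-∨ (r == c) (proj₁ f₆) (==-refl r)) j) c≢j ¬p) s≢j)

      no-e₂′ : r ≢ c → π r ≢ c → s ≢ c → e r s ≢ e c c
      no-e₂′ r≢c ¬p s≢c = refute _ _ (∨-skip s c (unlabelled-skip r c (proj₁ f₇) r≢c ¬p) s≢c)

      no-II : r ≡ c → π c ≡ s
      no-II refl = ==-sound _ _ (not-∨ (r == c) (proj₁ f₈) (==-refl r))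

      no-special : s ≢ π r → e c (π r) ≢ e c (π s)
      no-special n = refute _ _ (∨-skip s (π r) (proj₂ f₈) n)

    module Label (i j : Point) where
      private
        l₁ = ∧-elim (unlabelled i j ∨ not (e j i == e i j)) ((unlabelled i j ∨ not (e i i == e j j)) ∧
               every (f₁-at e N i j) (N j (e i i)) ∧ every (f₁′-at e N i j) (N i (e j i)))
               (everywhere²-sound (label-ok e N) (proj₂ s₄) i j)
        l₂ = ∧-elim (unlabelled i j ∨ not (e i i == e j j))
               (every (f₁-at e N i j) (N j (e i i)) ∧ every (f₁′-at e N i j) (N i (e j i))) (proj₂ l₁)
        l₃ = ∧-elim (every (f₁-at e N i j) (N j (e i i))) (every (f₁′-at e N i j) (N i (e j i))) (proj₂ l₂)

      no-a : i ≢ j → π i ≢ j → e j i ≢ e i j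
      no-a i≢j ¬p = refute _ _ (unlabelled-skip i j (proj₁ l₁) i≢j ¬p)

      no-a′ : i ≢ j → π i ≢ j → e i i ≢ e j j
      no-a′ i≢j ¬p = refute _ _ (unlabelled-skip i j (proj₁ l₂) i≢j ¬p)

      no-f₁ : ∀ {k} → i ≢ k → π i ≢ k → j ≢ i → j ≢ k → e i i ≡ e j k → e j i ≢ e k k
      no-f₁ {k} i≢k ¬p j≢i j≢k m = refute _ _ (∨-skip j k (∨-skip j i (unlabelled-skip i k
        (every-∈ (f₁-at e N i j) (N j (e i i)) (proj₁ l₃) (member i j i k m)) i≢k ¬p) j≢i) j≢k)

      no-f₁′ : ∀ {k} → k ≢ i → π k ≢ i → j ≢ k → j ≢ i → e j i ≡ e i k → e j k ≢ e k i
      no-f₁′ {k} k≢i ¬p j≢k j≢i m = refute _ _ (∨-skip j i (∨-skip j k (unlabelled-skip k i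
        (every-∈ (f₁′-at e N i j) (N i (e j i)) (proj₂ l₃) (member j i i k m)) k≢i ¬p) j≢k) j≢i)

  -- What the tests say about one table in terms of equal entries alone. The array and its transpose
  -- both satisfy it, so either orientation is treated in the same way.
  record Facts (e : Entries) : Set where
    field
      named   : ∀ c r → point (code (e c r) % P) ≡ e c r
      no-twin : ∀ {c d} → code c < code d → ∀ {r s} → r ≢ s → e c r ≡ e d s →
                e c s ≢ e d r ×
                (∀ {t} → s ≢ t → e c s ≡ e d t → e c t ≢ e d r)
      centre  : ∀ {c r s} → r ≢ s → e c r ≡ e c s → ∀ t → e c r ≡ e c t → t ≡ r ⊎ t ≡ s
      end     : ∀ {c r s} → r ≢ s → e c r ≡ e c s → ∀ d → d ≢ c → e d r ≢ e c r
      no-d₄   : ∀ {c r s} → r ≢ s → e c r ≡ e c s → ∀ {d t} → c ≢ d → r ≢ t → s ≢ t →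
                e d r ≡ e d t → e c t ≢ e d s
      no-d₂   : ∀ {c r s} → r ≢ s → e c r ≡ e c s → s ≡ c →
                ∀ {j} → c ≢ j → π c ≢ j → r ≢ j → e j r ≢ e j j
      no-d₂′  : ∀ {c r s} → r ≢ s → e c r ≡ e c s → c ≢ s → π c ≢ s → r ≢ c → e s r ≢ e s c
      no-e₂   : ∀ {c r s} → r ≢ s → e c r ≡ e c s → r ≡ c →
                ∀ {j} → c ≢ j → π c ≢ j → s ≢ j → e j s ≢ e c j
      no-e₂′  : ∀ {c r s} → r ≢ s → e c r ≡ e c s → r ≢ c → π r ≢ c → s ≢ c → e r s ≢ e c c
      no-II   : ∀ {c r s} → r ≢ s → e c r ≡ e c s → r ≡ c → π c ≡ s
      no-special : ∀ {c r s} → r ≢ s → e c r ≡ e c s → s ≢ π r → e c (π r) ≢ e c (π s)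
      no-a    : ∀ {i j} → i ≢ j → π i ≢ j → e j i ≢ e i j
      no-a′   : ∀ {i j} → i ≢ j → π i ≢ j → e i i ≢ e j j
      no-f₁   : ∀ {i j k} → i ≢ k → π i ≢ k → j ≢ i → j ≢ k → e i i ≡ e j k → e j i ≢ e k k
      no-f₁′  : ∀ {i j k} → k ≢ i → π k ≢ i → j ≢ k → j ≢ i → e j i ≡ e i k → e j k ≢ e k i

  facts : ∀ e N → T (single e N) → Facts e
  facts e N ok = record
    { named = symbol
    ; no-twin = λ c<d → twin-sound (twins-sound c<d)
    ; centre = Fork.centre ; end = Fork.end ; no-d₄ = Fork.no-d₄ ; no-d₂ = Fork.no-d₂ ; no-d₂′ = Fork.no-d₂′
    ; no-e₂ = Fork.no-e₂ ; no-e₂′ = Fork.no-e₂′ ; no-II = Fork.no-II ; no-special = Fork.no-special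
    ; no-a = Label.no-a _ _ ; no-a′ = Label.no-a′ _ _ ; no-f₁ = Label.no-f₁ _ _ ; no-f₁′ = Label.no-f₁′ _ _ }
    where open SingleFacts e N ok

  NoD₃ : Entries → Entries → Entries → Set
  NoD₃ e e′ x = ∀ {c r s y z} → r ≢ s → y ≢ z → e c r ≡ e c s → e′ c y ≡ e′ c z → x z s ≢ x y r

  -- Exchanging the two forks transposes the table joining their ends. This symmetry pairs up the
  -- eight orientation patterns, so four tests cover them all.
  NoD₃-swap : ∀ {e e′ x x′} → (∀ c r → x′ c r ≡ x r c) → NoD₃ e e′ x → NoD₃ e′ e x′
  NoD₃-swap x′≡ none r≢s y≢z m m′ h = none y≢z r≢s m′ m (trans (sym (x′≡ _ _)) (trans h (x′≡ _ _)))

  no-d₃ : ∀ e N e′ N′ x → T (single e N) → T (single e′ N′) → T (double e N e′ N′ x) → NoD₃ e e′ x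
  no-d₃ e N e′ N′ x ok ok′ ok″ {c} {r} {s} {y} {z} r≢s y≢z m m′ =
    refute _ _ (∨-skip y z (every-∈ (λ z → (y == z) ∨ not (x z s == x y r)) (N′ c (e′ c y))
      (everywhere-sound (λ y → every (λ z → (y == z) ∨ not (x z s == x y r)) (N′ c (e′ c y)))
        (SingleFacts.forks-sound e N ok
          (λ c r s → everywhere λ y → every (λ z → (y == z) ∨ not (x z s == x y r)) (N′ c (e′ c y)))
          ok″ c r s r≢s m) y)
      (SingleFacts.member e′ N′ ok′ c c y z m′)) y≢z)

-- The gadget obtained from a table that passes.

module Build (m : ℕ) (π : Point → Point) (U V : Point → Point → Point)
             (I J : Point → Point → List Point)
             (passed : Holds suite ((m , π) , U , V , I , J)) (V≡ : ∀ c r → V c r ≡ U r c) where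
  open Tests (suc m) π

  private
    ok : T (checks U V I J)
    ok = Holds.evidence passed

    o₁ = ∧-elim points-ok (single U I ∧ single V J ∧ double U I U I U ∧ doubles U I V J U V ∧ double V J V J V)
           ok
    o₂ = ∧-elim (single U I) (single V J ∧ double U I U I U ∧ doubles U I V J U V ∧ double V J V J V)
           (proj₂ o₁)
    o₃ = ∧-elim (single V J) (double U I U I U ∧ doubles U I V J U V ∧ double V J V J V)
           (proj₂ o₂)
    o₄ = ∧-elim (double U I U I U) (doubles U I V J U V ∧ double V J V J V)
           (proj₂ o₃)
    o₅ = ∧-elim (doubles U I V J U V) (double V J V J V)
           (proj₂ o₄)

    split : ∀ e N e′ N′ x y → T (single e N) → T (single e′ N′) → T (doubles e N e′ N′ x y) →
            NoD₃ (suc m) π e e′ x × NoD₃ (suc m) π e e′ y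
    split e N e′ N′ x y ok ok′ t =
      no-d₃ (suc m) π e N e′ N′ x ok ok′ (proj₁ hk) , no-d₃ (suc m) π e N e′ N′ y ok ok′ (proj₂ hk)
      where hk = ∧-elim (double e N e′ N′ x) (double e N e′ N′ y) t

    point-ok : ∀ i → T (π (π i) == i) × T (point (code i) == i)
    point-ok i = ∧-elim (π (π i) == i) (point (code i) == i)
      (everywhere-sound (λ i → (π (π i) == i) ∧ (point (code i) == i)) (proj₁ o₁) i)

    tab : Bool → Point → Point → Point
    tab true  = U
    tab false = V

    singles : ∀ b → Facts (suc m) π (tab b)
    singles true  = facts (suc m) π U I (proj₁ o₂)
    singles false = facts (suc m) π V J (proj₁ o₃)

    V≡′ : ∀ c r → U c r ≡ V r c
    V≡′ c r = sym (V≡ r c)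

    same : NoD₃ (suc m) π U U U
    same = no-d₃ (suc m) π U I U I U (proj₁ o₂) (proj₁ o₂) (proj₁ o₄)

    same′ : NoD₃ (suc m) π V V V
    same′ = no-d₃ (suc m) π V J V J V (proj₁ o₃) (proj₁ o₃) (proj₂ o₅)

    mixed : NoD₃ (suc m) π U V U × NoD₃ (suc m) π U V V
    mixed = split U I V J U V (proj₁ o₂) (proj₁ o₃) (proj₁ o₅)

    pairs : ∀ b b′ → NoD₃ (suc m) π (tab b) (tab b′) U × NoD₃ (suc m) π (tab b) (tab b′) V
    pairs true  true  = same , NoD₃-swap (suc m) π {U} {U} {U} {V} V≡ same
    pairs true  false = mixed
    pairs false true  = NoD₃-swap (suc m) π {U} {V} {V} {U} V≡′ (proj₂ mixed) ,
                        NoD₃-swap (suc m) π {U} {V} {U} {V} V≡ (proj₁ mixed)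
    pairs false false = NoD₃-swap (suc m) π {V} {V} {V} {U} V≡′ same′ , same′

    triples : ∀ b b′ b″ → NoD₃ (suc m) π (tab b) (tab b′) (tab b″)
    triples b b′ true  = proj₁ (pairs b b′)
    triples b b′ false = proj₂ (pairs b b′)

    module S (b : Bool) = Facts (singles b)

    φ : Bool → Point → Point → Fin (suc m)
    φ b r c = code (tab b c r) mod suc m

    -- Every symbol is fixed by reduction modulo the number of symbols, so equality in `Fin (suc m)`
    -- reflects equality in the table.
    entries : ∀ b b′ {r c r′ c′} → φ b r c ≡ φ b′ r′ c′ → tab b c r ≡ tab b′ c′ r′
    entries b b′ {r} {c} {r′} {c′} eq = begin
      tab b c r                          ≡⟨ sym (S.named b c r) ⟩
      point (code (tab b c r) % suc m)       ≡⟨ cong point (sym (Fin.toℕ-fromℕ< (m%n<n (code (tab b c r)) (suc m)))) ⟩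
      point (toℕ (φ b r c))                  ≡⟨ cong (point ∘ toℕ) eq ⟩
      point (toℕ (φ b′ r′ c′))               ≡⟨ cong point (Fin.toℕ-fromℕ< (m%n<n (code (tab b′ c′ r′)) (suc m))) ⟩
      point (code (tab b′ c′ r′) % suc m)    ≡⟨ S.named b′ c′ r′ ⟩
      tab b′ c′ r′                       ∎
      where open ≡-Reasoning

    code-injective : ∀ {c d} → code c ≡ code d → c ≡ d
    code-injective {c} {d} eq = trans (sym (decode c)) (trans (cong point eq) (decode d))
      where
      decode : ∀ i → point (code i) ≡ i
      decode i = ==-sound _ _ (proj₂ (point-ok i))

    no-twins : ∀ b {c d r s} → c ≢ d → r ≢ s → tab b c r ≡ tab b d s →
            tab b c s ≢ tab b d r ×
            (∀ {t} → r ≢ t → s ≢ t → tab b c s ≡ tab b d t → tab b c t ≢ tab b d r)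
    no-twins b {c} {d} {r} {s} c≢d r≢s m = by-order (<-cmp (code c) (code d))
      where
      by-order : Tri (code c < code d) (code c ≡ code d) (code d < code c) →
                 tab b c s ≢ tab b d r ×
                 (∀ {t} → r ≢ t → s ≢ t → tab b c s ≡ tab b d t → tab b c t ≢ tab b d r)
      by-order (tri< c<d _ _) = let h , k = S.no-twin b c<d r≢s m in h , λ _ → k
      by-order (tri≈ _ eq _)  = contradiction (code-injective eq) c≢d
      -- The same 2-cycle or 3-cycle, traversed backwards from d to c.
      by-order (tri> _ _ d<c) = let h , k = S.no-twin b d<c (r≢s ∘ sym) (sym m) in
        (λ m′ → h (sym m′)) , (λ r≢t _ m′ m″ → k r≢t (sym m″) (sym m′))

  gadget : Gadget Point (suc m)
  gadget = record
    { φ             = φ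
    ; φ-flip        = λ { true r c → cong (λ s → code s mod suc m) (V≡ r c)
                        ; false r c → cong (λ s → code s mod suc m) (sym (V≡ c r)) }
    ; partner       = π
    ; partner-invol = λ i → ==-sound _ _ (proj₁ (point-ok i))
    ; path-end      = λ b {r} {s} {c} {d} r≢s m m′ → end b r≢s (entries b b m) (entries b b m′)
    ; path-centre   = λ b {r} {s} {t} {c} r≢s m m′ → S.centre b r≢s (entries b b m) t (sym (entries b b m′))
    ; avoids-a      = λ b r≢s c≢d m m′ → proj₁ (no-twins b c≢d r≢s (entries b b m)) (entries b b m′)
    ; avoids-f₂     = λ b c₁≢c₃ r₀≢r₂ r₀≢r₄ r₂≢r₄ m m′ m″ →
        proj₂ (no-twins b c₁≢c₃ r₀≢r₂ (entries b b m)) r₀≢r₄ r₂≢r₄ (entries b b m′) (entries b b m″)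
    ; avoids-d₄     = λ b r₀≢r₂ r₀≢r₃ r₂≢r₃ c₁≢c₄ m m′ m″ →
        S.no-d₄ b r₀≢r₂ (entries b b m) c₁≢c₄ r₀≢r₃ r₂≢r₃ (entries b b m′) (entries b b m″)
    ; avoids-d₃     = λ b b′ b″ t₀≢t₂ t₄≢t₃ m m′ m″ →
        triples b b′ b″ t₀≢t₂ t₄≢t₃ (entries b b m) (entries b′ b′ m′) (entries b″ b″ m″)
    ; avoids-d₃-special = λ b {t₁} {t₂} {t₄} n n′ m m′ →
        S.no-special b n (entries b b m) (λ eq → n′ (trans eq (pp t₄)))
          (trans (cong (tab b t₁) (pp t₄)) (entries b b m′))
    ; label-a       = λ b i≢j ¬p → S.no-a b i≢j ¬p ∘ entries b b
    ; label-a′      = λ b i≢j ¬p → S.no-a′ b i≢j ¬p ∘ entries b b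
    ; label-II      = λ b i≢j ¬p m → ¬p (S.no-II b i≢j (entries b b m) refl)
    ; label-d₂      = λ b i≢j ¬p k≢i k≢j m m′ →
        S.no-d₂ b k≢i (entries b b m) refl i≢j ¬p k≢j (entries b b m′)
    ; label-d₂′     = λ b i≢j ¬p k≢i k≢j m m′ →
        S.no-d₂′ b k≢j (entries b b m) i≢j ¬p k≢i (entries b b m′)
    ; label-e₂      = λ b i≢j ¬p k≢i k≢j m m′ →
        S.no-e₂ b (k≢i ∘ sym) (entries b b m) refl i≢j ¬p k≢j (entries b b m′)
    ; label-e₂′     = λ b i≢j ¬p k≢i k≢j m m′ →
        S.no-e₂′ b (k≢i ∘ sym) (entries b b m) i≢j ¬p k≢j (entries b b m′)
    ; label-f₁      = λ b {i} {j} {k} i≢j ¬p k≢i k≢j m m′ →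
        S.no-f₁ b i≢j ¬p k≢i k≢j (entries b b m) (entries b b m′)
    ; label-f₁′     = λ b {i} {j} {k} i≢j ¬p k≢i k≢j m m′ →
        S.no-f₁′ b i≢j ¬p k≢i k≢j (sym (entries b b m)) (entries b b m′)
    }
    where
    pp : ∀ i → π (π i) ≡ i
    pp i = ==-sound _ _ (proj₁ (point-ok i))
    end : ∀ b {r s c d} → r ≢ s → tab b c r ≡ tab b c s → tab b d r ≡ tab b c r → d ≡ c
    end b {c = c} {d} r≢s m m′ = decidable-stable (d ≟ c) λ d≢c → S.end b r≢s m d d≢c m′

transpose-! : ∀ U c r → transpose U ! c ! r ≡ U ! r ! c
transpose-! U c r = trans (cong (_! r) (tabulate-! (λ i → tabulate λ j → U ! j ! i) c)) (tabulate-! (λ j → U ! j ! c) r)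

-- The auxiliary tables stay variables for the consumer: unfolding them on a neutral U would explode.
from-shared : ∀ {X A B : Set} (q : B × A → Bool) (y : B) (k : Table → Table → EndTable → EndTable → A) U →
              (∀ V I J → (∀ c r → V ! c ! r ≡ U ! r ! c) → Holds q (y , k U V I J) → X) →
              Holds q (y , shared k U) → X
from-shared q y k U use ok = use (transpose U) (inverse U) (inverse (transpose U)) (transpose-! U) ok

gadget : ∀ m p U → Holds suite ((m , (p !_)) , shared lookups U) → Gadget Point (suc m)
gadget m p U = from-shared suite (m , (p !_)) lookups U
  λ V I J V≡ ok → Build.gadget m (p !_) (λ c r → U ! c ! r) (λ c r → V ! c ! r)
                                        (λ c k → I ! c ! k) (λ c k → J ! c ! k) ok V≡

-- The explicit array.

-- Row c lists the symbols at centre c in base 100, least significant digit first; likewise for partners.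
symbols : Table
symbols = trie (row 0) (map row (
  15044226014624333147200940463844252858610007183943114521484155120236542905032923545630066049355244171025183027505922531922591608 ∷
  5142743470032254630082147414539292460590601381910422044404913543703285502042228575507314861533416452411311951262358185258230917 ∷
  7051425572450225153091843121930394838043840005906010261311723201029443527151140491328163746475545544234411518522126273236605846 ∷
  4062415255623515250190813423118493805394139580100076003163021222811344514264110124817294736544655443543144053192720332661374759 ∷
  25093203082214391756071951243461524401291103203848362143592430552616156006504946000553472851373942233110574305580445543335410227 ∷
  8240233230938155716180625506035455328000210392137494220255854311727611451074748040146525029383622431130425659044405325540342603 ∷
  34111000383106492661400839014305092126582747595214283506035519372936504242195344133335391718075746253055225160124556230224103132 ∷
  10350111303948076027094100380442200859274626535829150734540236183728435118434552321238341916560624475431502313615744032211253330 ∷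
  24551245274522480554376000070440191141312910344953182830574456581443092547594433503255263956284215402001614606031608385217050721 ∷
  54254413442649235504613606014105101830401128483519523129455659574215240858463245335127545738432941140021476002070917533904162006 ∷
  38244333221036202755604307140147130712464058302131062335051500115045570308163250481745250252044126190449093934593014131842534437 ∷
  25393242112321375426426115064600061247135941203107303422140410014451025617095133164924445303400518274805380858351531191252433645 ∷
  49076016414309081023593634150533225852035355044225455426565035302713311248480257171158041554460114246129510617003739201927443032 ∷
  6481761424009082211375814353204592302535452430544242755515731341226133049495603101605595514004725152860075001163836182145263331 ∷
  27535835456157430042284018593350573156551346541503566011293110212430173636473405432508200919022652163932413844182821060137582248 ∷
  52263459604442564301412958195132305654574712145557021061302820113125371646370435244221091808270317533338394019452029000759364923 ∷
  19454120073304114400583431575321233536203017281039321905552601470049062224030929391425385435166002084654511332404210375943275029 ∷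
  44182140320610050145355956302052342221371631112933380418275446004801230702252808153839243455611709035547125041331143583626422851 ∷
  12370824051330021451302852445459382745493642071160533833150961580350221855200134262940162417413347465748210425291934590605524135 ∷
  36132509120403315015293145535855263948444337100652613239081459605102192321543500282717411625324047464956052028243518075853043440 ∷
  47491646024800181906566023095443290336281850012838445902320834615635583757141726071539102142525849044008130151304111331545312220 ∷
  48464717490319010718615708224255022829375119290045390358093360353457365915562716140611384320595305480941001231501040143230442123 ∷
  16383537152913060924103954301154215553412349484261292519465317195207002144415836564718011040085060312659223412433407260420574502 ∷
  39173634281407122508381131555510542040524822434928601824524718160653200140453759465700194111510930615827352342130635052756210344 ∷
  58310953564708461813250724114838162906501520105121424427043603355533601959330849413052002215483238011761242737233906284302145761 ∷
  30595208465747091219062410253949281751072114501143202645370534023254186132584809314001531423334900396016262522360738422915036056 ∷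
  17292851155534300058361633232211265942012002603531575714245250414910405456386121370708366104094306121603134524324601054814531247 ∷
  28165029541431355901173722321023582700430321346156301556532540511148554139572060063637090560420813070217441233250047490452154613 ∷
  15215905553252381349395638185258081403425729362310371151432602066139465035223051223109534034584454602033162461014728312512461948 ∷
  20140458335439534812573819395953150943022856223736115010274207033860514723345031302352083541455961553221251700602946243047134918 ∷
  53340557342125470403133926331756473627543702132054100015506009383052112307123142294148570658032255432501284144154519125118094060 ∷
  35525604203546240205381232275716374655260336211211551401615139085331221013064330402856495907230242540024402914451844501308196141 ∷
  51420054192040444136323204344902001817581033164420403707125745254706300933280355533551053843112608272146082829565254486023613924 ∷
  43505501211845413740333335050348190159163211451741210636561324440746083129325402345204504239271026094720290957285553614960222538 ∷
  42360712485259452037555332615031244125351938400849256117601826363409230109042146051014300859144743585153060315221311021654062433 ∷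
  37431306534944583621525460333051402534243918094124481660196137270835002205084720110431155809461559425250020723141012170307553225 ∷
  14193025521927574524352316602306334920120811425115595309220139051700474816290743601061411302305450324528345831213346555606180338 ∷
  18152431185356262544223461170722483213211009504358140852002304380116494628174206116140600312553133512944593520304732575419073902 ∷
  93507105855271457164903084012415424150636605346225950475625504505042628522154021719133245183027012331431138513223420529330407 ∷
  8010634591126545615481709021341554014253707526123475158574651240444270553295520160312184433311900263022104250392233044332280605 ∷
  11232908400758103542120405592101140309225624123447162937382015483338573243253137534336451927261628525100391354414950066160470515 ∷
  22100928064111594334051358040020021523082557351317463628213949143932335624423630425244372618172753290150123840555148600746611404 ∷
  3041838426010325361510129523745463611303448415826070044490627092517212850403312203443332301501105205635152257025459163109390855 ∷
  5023919614333116052005053284436374731104935594006274501074808261624292041511332352132420022105121043457231403565855301738085409 ∷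
  46571502040841201943472117362809441151185552250940051316260706322361381535101422550031372748346145563658275929442460033448245022 ∷
  56470314090521404218204637160829104519505354082404411712062733076022143911342315015436304926603557445937582645286125350225492351 ∷
  32614560262843193417235001213614070422380923462713585330415929565810414915165918442247484505061252510312110207312539204231350014 ∷
  60336144292718421635512220001537050639232208264759123152584057281159484017141958234549460444130750531302031030063824432134301501 ∷
  2004018535137143041263527490646044403110713242034081204013358395714324561275247365054252913232431103709595522051257363816175643 ∷
  1031941505215364031342748264707450510021206212509350513320038591556443326604653513724551228252211300836545804235613393716174257 ∷
  55274632350220602239295242371460315047085804051730594925341043282315245819551857443903515621123811130640365448410561014533001626 ∷
  26543347033461213823532836436115513009460559160458312448113529421422592554185619384550022057391312104107553740496004440001322717 ∷
  9415421112322522902064557583630356037096015195732134038311626424055534325390312072448350147335604501814046110465351342844201334 ∷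
  40082055221053230328440759563137613408361461561812333941173043275441425238241302250634494600573251051519600547115052293521453512 ∷
  45285752390128005820500550135127603361192416032642314123440314465521251104365456095347170732403036332204174943020838091457484811 ∷
  29445356003801292159045112512650326118601725270230432240024547152054102437055755520816463306314132370523481603423909150849561049 ∷
  26301236375129503907455519472717544207560805314335042359182128495242393460352527580922111300243720363357491046401403215341025358 ∷
  31273713503651280638544446181626435557060409423005345822201948294353353834612624085910230112362537215632114841470215522003405952 ∷
  45053353124260554909031711405615231316480143573618504100393402103604072752111638594626145237292039221906194721343149282430385154 ∷
  4445232431354610848160241101457122249174200375651190140353811030537260610533917475815273653212823380718461835204830252939315550 ∷
  43402327362517052814491049541828535732146129413008511107163500531318062446134001034460223150194810593452374212383626560920025539 ∷
  41422622243704161529114855482919565215332860314050090610341752011912250712470041450223615130491858115335433639132737085703213854 ∷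
  50584909171233034722152548324308115150455946476004545242132955401830011400020516192806262510370729353841445334173127113951201836 ∷
  59510848131602322346241433490942501044514758614655054353281241543119150003011704291827071124063634284039524516352630381021503719 ∷
  []))

partners : Trie Point
partners = row
  12130908212029285352555406072223414035342425474604050001454431303332575610114243484959581415030218196263262761605051383917163637

-- Orders that are dense up to a constant factor.

module _ {S : ℕ → Set} {lo s hi : ℕ} (q₀ : ℕ) (Sq₀ : S q₀) (start : lo * q₀ + s ≤ hi * q₀)
         (next : ∀ {q} → q₀ ≤ q → S q → ∃ λ q′ → q ≤ q′ × S q′ × suc (hi * q) ≤ hi * q′ × lo * q′ + s ≤ hi * q) where

  -- The order q serves the numbers from lo q + s to hi q. By `next` the interval of some larger
  -- order starts no later than this one ends, so moving upwards leaves no gap.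
  cover : ∀ k → ∃ λ q → q₀ ≤ q × S q × lo * q + s ≤ k + (lo * q₀ + s) × k + (lo * q₀ + s) ≤ hi * q
  cover zero = q₀ , ≤-refl , Sq₀ , ≤-refl , start
  cover (suc k) with cover k
  ... | q , q₀≤q , Sq , l , u with suc k + (lo * q₀ + s) ≤? hi * q
  ...   | yes u′ = q , q₀≤q , Sq , m≤n⇒m≤1+n l , u′
  ...   | no ¬u with next q₀≤q Sq
  -- The number has just passed hi q, hence equals hi q + 1. It is at most hi q′ and exceeds lo q′ +
  -- s.
  ...     | q′ , q≤q′ , Sq′ , gr , cl =
    q′ , ≤-trans q₀≤q q≤q′ , Sq′ , ≤-trans cl (≤-trans (n≤1+n _) (≰⇒> ¬u)) , ≤-trans (s≤s u) gr


module Powers (p q lo s hi : ℕ) .{{_ : NonZero p}} .{{_ : NonTrivial q}} .{{_ : NonZero hi}} (i j k l : ℕ)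
  (up₁ : p ^ i < q ^ j) (close₁ : lo * q ^ j + s ≤ hi * p ^ i)
  (up₂ : q ^ k < p ^ l) (close₂ : lo * p ^ l + s ≤ hi * q ^ k) where

  private instance
    q≢0 : NonZero q
    q≢0 = nonTrivial⇒nonZero q

  Power : ℕ → Set
  Power m = ∃₂ λ a b → m ≡ p ^ a * q ^ b

  m₀ : ℕ
  m₀ = p ^ i * q ^ k

  scale : ∀ {r r′} c .{{_ : NonZero c}} → lo * r′ + s ≤ hi * r → lo * (r′ * c) + s ≤ hi * (r * c)
  scale {r} {r′} c close = begin
    lo * (r′ * c) + s      ≤⟨ +-monoʳ-≤ _ (m≤m*n s c) ⟩
    lo * (r′ * c) + s * c  ≡⟨ cong (_+ s * c) (sym (*-assoc lo r′ c)) ⟩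
    lo * r′ * c + s * c    ≡⟨ sym (*-distribʳ-+ c (lo * r′) s) ⟩
    (lo * r′ + s) * c      ≤⟨ *-monoˡ-≤ c close ⟩
    hi * r * c             ≡⟨ *-assoc hi r c ⟩
    hi * (r * c)           ∎
    where open ≤-Reasoning

  -- Trading a factor p^i for q^j, or q^k for p^l, enlarges m by a factor so close to 1 that the
  -- intervals still overlap. From m₀ on, at least one of the trades is possible.
  next : ∀ {m} → m₀ ≤ m → Power m →
         ∃ λ m′ → m ≤ m′ × Power m′ × suc (hi * m) ≤ hi * m′ × lo * m′ + s ≤ hi * m
  next {m} m₀≤m (a , b , refl) with i ≤? a | k ≤? b
  ... | yes i≤a | _ = q ^ j * c , <⇒≤ m<m′ , (a ∸ i , j + b , m′≡) , *-monoʳ-< hi m<m′ ,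
                      subst (λ t → lo * (q ^ j * c) + s ≤ hi * t) (sym m≡) (scale c close₁)
    where
    c = p ^ (a ∸ i) * q ^ b
    instance
      c≢0 : NonZero c
      c≢0 = m*n≢0 (p ^ (a ∸ i)) (q ^ b) {{m^n≢0 p (a ∸ i)}} {{m^n≢0 q b}}
    m≡ : p ^ a * q ^ b ≡ p ^ i * c
    m≡ = begin
      p ^ a * q ^ b                 ≡⟨ cong (λ t → p ^ t * q ^ b) (sym (m+[n∸m]≡n i≤a)) ⟩
      p ^ (i + (a ∸ i)) * q ^ b     ≡⟨ cong (_* q ^ b) (^-distribˡ-+-* p i (a ∸ i)) ⟩
      p ^ i * p ^ (a ∸ i) * q ^ b   ≡⟨ *-assoc (p ^ i) _ _ ⟩
      p ^ i * c                     ∎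
      where open ≡-Reasoning
    m′≡ : q ^ j * c ≡ p ^ (a ∸ i) * q ^ (j + b)
    m′≡ = begin
      q ^ j * (p ^ (a ∸ i) * q ^ b)   ≡⟨ x∙yz≈y∙xz (q ^ j) (p ^ (a ∸ i)) (q ^ b) ⟩
      p ^ (a ∸ i) * (q ^ j * q ^ b)   ≡⟨ cong (p ^ (a ∸ i) *_) (sym (^-distribˡ-+-* q j b)) ⟩
      p ^ (a ∸ i) * q ^ (j + b)       ∎
      where open ≡-Reasoning
            open import Algebra.Properties.CommutativeSemigroup *-commutativeSemigroup using (x∙yz≈y∙xz)
    m<m′ : p ^ a * q ^ b < q ^ j * c
    m<m′ = subst (_< q ^ j * c) (sym m≡) (*-monoˡ-< c up₁)
  ... | no _ | yes k≤b = p ^ l * c , <⇒≤ m<m′ , (l + a , b ∸ k , m′≡) , *-monoʳ-< hi m<m′ ,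
                      subst (λ t → lo * (p ^ l * c) + s ≤ hi * t) (sym m≡) (scale c close₂)
    where
    c = p ^ a * q ^ (b ∸ k)
    instance
      c≢0 : NonZero c
      c≢0 = m*n≢0 (p ^ a) (q ^ (b ∸ k)) {{m^n≢0 p a}} {{m^n≢0 q (b ∸ k)}}
    m≡ : p ^ a * q ^ b ≡ q ^ k * c
    m≡ = begin
      p ^ a * q ^ b                   ≡⟨ cong (λ t → p ^ a * q ^ t) (sym (m+[n∸m]≡n k≤b)) ⟩
      p ^ a * q ^ (k + (b ∸ k))       ≡⟨ cong (p ^ a *_) (^-distribˡ-+-* q k (b ∸ k)) ⟩
      p ^ a * (q ^ k * q ^ (b ∸ k))   ≡⟨ x∙yz≈y∙xz (p ^ a) (q ^ k) (q ^ (b ∸ k)) ⟩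
      q ^ k * c                       ∎
      where open ≡-Reasoning
            open import Algebra.Properties.CommutativeSemigroup *-commutativeSemigroup using (x∙yz≈y∙xz)
    m′≡ : p ^ l * c ≡ p ^ (l + a) * q ^ (b ∸ k)
    m′≡ = trans (sym (*-assoc (p ^ l) _ _)) (cong (_* q ^ (b ∸ k)) (sym (^-distribˡ-+-* p l a)))
    m<m′ : p ^ a * q ^ b < p ^ l * c
    m<m′ = subst (_< p ^ l * c) (sym m≡) (*-monoˡ-< c up₂)
  -- If a < i and b < k, then p^a q^b lies below m₀.
  ... | no i≰a | no k≰b = contradiction m₀≤m (<⇒≱ (begin-strict
      p ^ a * q ^ b  ≤⟨ *-monoˡ-≤ (q ^ b) (^-monoʳ-≤ p (<⇒≤ (≰⇒> i≰a))) ⟩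
      p ^ i * q ^ b  <⟨ *-monoʳ-< (p ^ i) {{m^n≢0 p i}} (^-monoʳ-< q (nonTrivial⇒n>1 q) (≰⇒> k≰b)) ⟩
      p ^ i * q ^ k  ∎))
    where open ≤-Reasoning

  q≥ : ∀ k → ∃ λ m → m₀ ≤ m × Power m × lo * m + s ≤ k + (lo * m₀ + s) × k + (lo * m₀ + s) ≤ hi * m
  q≥ = cover {Power} {lo} {s} {hi} m₀ (i , k , refl) (≤-trans (+-monoˡ-≤ s (*-monoʳ-≤ lo (*-monoˡ-≤ (q ^ k) (<⇒≤ up₁)))) (scale (q ^ k) {{m^n≢0 q k}} close₁)) next

-- The concrete gadget, the available orders and the theorem.

table-gadget : Gadget Point 62
-- With 61 the number of symbols is `suc 61`, that is 62. The proof `tt` is accepted by evaluating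
-- all tests on the array.
table-gadget = gadget 61 partners symbols (holds tt)

point↔ : Point ↔ Fin 64
point↔ = mk↔ₛ′ to (point ∘ toℕ) to∘from from∘to
  where
  bound : ∀ i → code i < 64
  bound i = <ᵇ⇒< (code i) 64 (everywhere-sound (λ i → code i <ᵇ 64) tt i)
  to : Point → Fin 64
  to i = fromℕ< (bound i)
  to∘from : ∀ n → to (point (toℕ n)) ≡ n
  to∘from n = Fin.toℕ-injective (trans (Fin.toℕ-fromℕ< (bound (point (toℕ n))))
    (≡ᵇ⇒≡ _ _ (all<-sound 64 (λ n → code (point n) ≡ᵇ n) tt (Fin.toℕ<n n))))
  from∘to : ∀ i → point (toℕ (to i)) ≡ i
  from∘to i = trans (cong point (Fin.toℕ-fromℕ< (bound i)))
    (==-sound _ _ (everywhere-sound (λ i → point (code i) == i) tt i))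

-- 11 ^ 17 / 23 ^ 13 and 23 ^ 790 / 11 ^ 1033 both lie strictly between 1 and 64 / 63.
module Orders = Powers 11 23 63 4096 64 1033 790 13 17
  (<ᵇ⇒< _ _ tt) (≤ᵇ⇒≤ _ _ tt) (<ᵇ⇒< _ _ tt) (≤ᵇ⇒≤ _ _ tt)

quasigroup : ∀ {m} → Orders.Power m → ∃ λ Q → RigidQuasigroup.order Q ≡ m
quasigroup (i , j , refl) =
  power order-11 i ⊗ power order-23 j , cong₂ _*_ (order-power order-11 i) (order-power order-23 j)

-- The summands count 62 m cross colours, m special colours and 64 · 64 labels. The right-hand side
-- is the lower end of the interval that the order m serves in `Orders`.
palette-size : ∀ m → 62 * m + (m + 4096) ≡ 63 * m + 4096
palette-size m = trans (sym (+-assoc (62 * m) m 4096)) (cong (_+ 4096) (+-comm (62 * m) m))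

-- `Orders.m₀` has more than a thousand decimal digits. The threshold stays opaque, and the theorem
-- uses only the inequalities of `order-for`.
abstract
  threshold : ℕ
  threshold = 63 * Orders.m₀ + 4096

  order-for : ∀ n → threshold ≤ n → ∃ λ m → Orders.Power m × 62 * m + (m + 4096) ≤ n × n ≤ m * 64
  order-for n N≤n = let m , _ , powers , lower , upper = Orders.q≥ (n ∸ threshold) in
    m , powers , subst₂ _≤_ (sym (palette-size m)) (m∸n+n≡m N≤n) lower ,
    subst₂ _≤_ (m∸n+n≡m N≤n) (*-comm 64 m) upper

theorem4p2 : Σ ℕ λ p → Σ ℕ λ q → 0 < p × 0 < q ×
    Σ ℕ λ N → ∀ (n : ℕ) → N ≤ n →
    Σ (PColouring n) λ col →
    WellFormed col ×
    (∀ (i : Fin n) → ClassIsEdgesAnd2Paths col i) ×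
    TriangleProperty col ×
    NoBadSubgraph col ×
    MaxDegL col p q ×
    FewCompletions col p q
-- The fraction 1 / 1 makes the bound n^(1-δ) equal to 1, and the numbers to be bounded are 0
-- because every edge is coloured.
theorem4p2 = 1 , 1 , s≤s z≤n , s≤s z≤n , threshold , λ n N≤n →
  let m , powers , lower , upper = order-for n N≤n
      Q , order≡m = quasigroup powers
      palette≤n  = subst (λ m → 62 * m + (m + 4096) ≤ n) (sym order≡m) lower
      n≤vertices = subst (λ m → n ≤ m * 64) (sym order≡m) upper
      open Blowup Q point↔ table-gadget
  in col palette≤n n≤vertices , well-formed palette≤n n≤vertices , classes palette≤n n≤vertices ,
     triangles palette≤n n≤vertices , no-bad palette≤n n≤vertices , max-degree palette≤n n≤vertices ,
     few-completions palette≤n n≤vertices
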